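{- Let $r\ge 2$ be a fixed integer and let $\mathbb{RM}_n$ denote a uniformly random ordered $r$-matching of size $n$ on the vertex set $[rn]$. Then asymptotically almost surely $t(\mathbb{RM}_n)=\Theta\left(n^{\frac{2}{r+1}}\right)$; that is, there exist constants $0<c\le C$ (depending only on $r$) such that $$\lim_{n\to\infty}\mathbb{P}\left(c\, n^{\frac{2}{r+1}}\le t(\mathbb{RM}_n)\le C\, n^{\frac{2}{r+1}}\right)=1.$$
   Context: An ordered $r$-matching of size $n$ is an $r$-uniform hypergraph on a linearly ordered vertex set $V$ with $|V|=rn$, consisting of $n$ pairwise disjoint edges (equivalently, a word with $n$ distinct letters each occurring exactly $r$ times). Two ordered matchings are isomorphic if there is an order-preserving bijection between their vertex sets inducing a bijection between their edge sets. A pair of twins in an ordered matching $M$ is a pair of vertex-disjoint sub-matchings of $M$ (sub-matching = subset of the edges) that are isomorphic as ordered matchings; the size of the twins is the number of edges in one of them. $t(M)$ denotes the maximum size of twins in $M$. $\mathbb{RM}_n$ is chosen uniformly among all $\frac{(rn)!}{(r!)^n n!}$ $r$-matchings on $[rn]$ (with the natural order). -}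

module Defs where

open import Data.Nat using (ℕ; zero; suc; _+_; _*_; _^_; _≤_; _<_; _∸_; _!)

open import Data.Fin as F using (Fin; toℕ)
open import Data.Fin.Properties using (_≟_)
open import Data.Fin.Subset using (Subset; _∈_; ∣_∣; _∩_; Empty)
open import Data.Vec using (Vec; lookup; count)
open import Data.List using (List; length)
open import Data.List.Relation.Unary.All using (All)
open import Data.List.Relation.Unary.Unique.Propositional using (Unique)
open import Data.Product using (Σ; ∃; _×_)
open import Function.Bundles using (_⇔_)
open import Relation.Binary.PropositionalEquality using (_≡_)

Word : ℕ → ℕ → Set
Word m n = Vec (Fin n) m

-- An ordered r-matching of size n on [rn], represented canonically as a word of
-- length r*n in which every letter a : Fin n occurs exactly r times (the edges are
-- the letter classes) and letters are numbered in order of first occurrence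
-- (every occurrence of letter a+1 is preceded by an occurrence of letter a).
-- This gives a bijection with the set of r-matchings on [rn] (perfect partitions
-- of [rn] into r-sets), so counting such words counts matchings.
IsMatching : (r n : ℕ) → Word (r * n) n → Set
IsMatching r n w =
  (∀ (a : Fin n) → count (_≟ a) w ≡ r) ×
  (∀ (i : Fin (r * n)) (a : ℕ) → toℕ (lookup w i) ≡ suc a →
     ∃ λ (j : Fin (r * n)) → (toℕ j < toℕ i) × (toℕ (lookup w j) ≡ a))

InSub : ∀ {m n} → Word m n → Subset n → Fin m → Set
InSub w S i = lookup w i ∈ S

IsoSub : ∀ {m n} → Word m n → Subset n → Subset n → Set
IsoSub {m} w S T = Σ (Fin m → Fin m) λ f →
  (∀ i → InSub w S i → InSub w T (f i)) ×
  (∀ i j → InSub w S i → InSub w S j → toℕ i < toℕ j → toℕ (f i) < toℕ (f j)) ×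
  (∀ j → InSub w T j → ∃ λ i → InSub w S i × (f i ≡ j)) ×
  (∀ i j → InSub w S i → InSub w S j →
     (lookup w i ≡ lookup w j) ⇔ (lookup w (f i) ≡ lookup w (f j)))

Twins : ∀ {m n} → Word m n → ℕ → Set
Twins {n = n} w k = Σ (Subset n) λ S → Σ (Subset n) λ T →
  Empty (S ∩ T) × IsoSub w S T × (∣ S ∣ ≡ k)

TwinNumber : ∀ {m n} → Word m n → ℕ → Set
TwinNumber w k = Twins w k × (∀ k' → Twins w k' → k' ≤ k)

-- Event: c n^{2/(r+1)} ≤ t(M) ≤ C n^{2/(r+1)} with c = cn/cd, C = Cn/Cd,
-- written after raising to the (r+1)-th power.
InWindow : (r n cn cd Cn Cd t : ℕ) → Set
InWindow r n cn cd Cn Cd t =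
  (cn ^ (r + 1) * n ^ 2 ≤ cd ^ (r + 1) * t ^ (r + 1)) ×
  (Cd ^ (r + 1) * t ^ (r + 1) ≤ Cn ^ (r + 1) * n ^ 2)

Good : (r n cn cd Cn Cd : ℕ) → Word (r * n) n → Set
Good r n cn cd Cn Cd w =
  IsMatching r n w × ∃ λ t → TwinNumber w t × InWindow r n cn cd Cn Cd t

-- P(Good) ≥ 1 - 1/k for the uniform distribution on the
-- (rn)!/((r!)^n n!) matchings: there is a duplicate-free list of good matchings L with
-- |L| / ((rn)!/((r!)^n n!)) ≥ 1 - 1/k, i.e. k |L| (r!)^n n! ≥ (k-1) (rn)!.
ProbAtLeast : (r n cn cd Cn Cd k : ℕ) → Set
ProbAtLeast r n cn cd Cn Cd k =
  Σ (List (Word (r * n) n)) λ L →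
    Unique L × All (Good r n cn cd Cn Cd) L ×
    ((k ∸ 1) * ((r * n) !) ≤ k * length L * ((r !) ^ n * (n !)))

{-# OPTIONS --safe #-}
-- Give each of n edges r independent uniform labels in Fin K, with K = N Q huge; up to rare ties, sorting
-- the labels yields a uniform random matching, since every matching has the same bounded number of
-- preimages. Independence replaces the depletion effects of sampling without replacement.
--
-- Upper bound: first moment. Fix t edges σ, t edges τ and how the slots of the former match those of the
-- latter. Given the labels of σ, the relative order of the rt labels of τ is prescribed, which has
-- probability at most 1 / (rt)!. Summing over all choices gives (C n² / tʳ⁺¹)ᵗ.
--
-- Lower bound: cut the label range into N ~ n^(2/(r+1)) intervals, so that every edge has a box in (Fin N)ʳ.
-- Two edges with the same box are interchangeable, and such pairs can be combined freely as long as their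
-- boxes use disjoint sets of intervals. The pairs are found greedily: the first edges provide many boxes of
-- bounded degree, and each later edge hits an available one of them with probability of order N / n.
module Submission where

open import Defs
open import Data.Nat
open import Data.Nat.Properties
open import Data.Nat.DivMod using (_/_; m≡m%n+[m/n]*n; m%n<n; m/n*n≤m)
open import Data.Nat.Tactic.RingSolver using (solve-∀)
open import Data.Fin as F using (Fin; toℕ; zero; suc)
import Data.Fin.Properties as FP
open import Data.Fin.Subset as S using (Subset; inside; outside; ∣_∣)
import Data.Fin.Subset.Properties as SP
open import Data.Vec as V using (Vec; []; _∷_)
import Data.Vec.Properties as VP
import Data.Vec.Relation.Unary.All as VA
import Data.Vec.Relation.Unary.AllPairs as VAP
import Data.Vec.Relation.Unary.Unique.Propositional as VU
import Data.Vec.Relation.Unary.Unique.Propositional.Properties as VUP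
open import Data.List as L using (List; []; _∷_; length; _++_; filter; cartesianProductWith; cartesianProduct; concatMap; deduplicate)
import Data.List.Properties as LP
open import Data.List.Membership.Propositional using (_∈_; _∉_; lose)
open import Data.List.Membership.Propositional.Properties
open import Data.List.Relation.Unary.Any as Any using (Any; here; there)
open import Data.List.Relation.Unary.All as All using (All; []; _∷_)
import Data.List.Relation.Unary.All.Properties as AllP
open import Data.List.Relation.Unary.AllPairs as AP using (AllPairs; []; _∷_)
import Data.List.Relation.Unary.AllPairs.Properties as APP
open import Data.List.Relation.Unary.Unique.Propositional using (Unique)
import Data.List.Relation.Unary.Unique.Propositional.Properties as UP
import Data.List.Relation.Unary.Unique.DecPropositional.Properties as UDP
open import Data.List.Relation.Binary.Sublist.Propositional using (_⊆_; []; _∷_; _∷ʳ_; ⊆-trans)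
import Data.List.Relation.Binary.Sublist.Propositional.Properties as SLP
open import Data.List.Relation.Binary.Permutation.Propositional using (_↭_; ↭-refl; ↭-sym; ↭-trans; ↭-prep)
import Data.List.Relation.Binary.Permutation.Propositional.Properties as PP
open import Data.List.Relation.Binary.Permutation.Propositional using (↭⇒↭ₛ)
import Data.List.Relation.Binary.Permutation.Setoid.Properties as PSP
open import Data.List.Relation.Unary.Linked.Properties using (Linked⇒AllPairs)
import Data.List.Sort
import Relation.Binary.Construct.On as On
open import Data.Product using (Σ; ∃; _×_; _,_; proj₁; proj₂; uncurry)
open import Data.Sum using (_⊎_; inj₁; inj₂)
open import Data.Empty using (⊥-elim)
open import Function using (_∘_; id; case_of_)
open import Function.Bundles using (_⇔_; mk⇔; Equivalence)
open import Relation.Nullary using (¬_; Dec; yes; no; ¬?)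
open import Relation.Nullary.Decidable as Dec using (_×-dec_; _→-dec_; map′)
open import Relation.Unary using (Decidable)
open import Relation.Binary.Definitions using (DecidableEquality; tri<; tri≈; tri>)
open import Relation.Binary.PropositionalEquality

-- The exponent comes from a balance. About n² / Nʳ pairs of edges share a box, while boxes on
-- disjoint sets of intervals number at most N / r; the two agree up to constants when Nʳ⁺¹ is of
-- order n². The first moment passes from large to small at the same order of t. The obstacle in the
-- greedy search is dependence: whether a new edge completes a pair depends on all earlier boxes.
-- Splitting the edges into two batches freezes the collection before pairs are counted. Given any
-- past, each draw then succeeds with a probability bounded below, and an exponential potential
-- makes failure exponentially unlikely. Probabilities are ratios of list lengths, cleared of
-- denominators. The passage to matchings uses an upper bound on the number of preimages of a word:
-- it turns many typical outcomes into many good matchings, which is the form of `ProbAtLeast`.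

-- Counting with duplicate-free lists

unique-inj-length : {A B : Set} (f : A → B) {xs : List A} {ys : List B} → Unique xs →
  (∀ {x} → x ∈ xs → f x ∈ ys) →
  (∀ {x y} → x ∈ xs → y ∈ xs → f x ≡ f y → x ≡ y) →
  length xs ≤ length ys
unique-inj-length f {[]} _ _ _ = z≤n
unique-inj-length f {x ∷ xs} (x∉ ∷ u) into inj with ∈-∃++ (into (here refl))
... | as , bs , refl = subst (suc (length xs) ≤_) (sym (LP.length-++-sucʳ as (f x) bs))
  (s≤s (unique-inj-length f u into′ (λ p q → inj (there p) (there q))))
  where
  into′ : ∀ {y} → y ∈ xs → f y ∈ as ++ bs
  into′ {y} y∈ with ∈-++⁻ as (into (there y∈))
  ... | inj₁ p = ∈-++⁺ˡ p
  ... | inj₂ (there p) = ∈-++⁺ʳ as p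
  ... | inj₂ (here e) = ⊥-elim (All.lookup x∉ y∈ (sym (inj (there y∈) (here refl) e)))

unique-⊆-length : {A : Set} {xs ys : List A} → Unique xs → (∀ {x} → x ∈ xs → x ∈ ys) →
  length xs ≤ length ys
unique-⊆-length u sub = unique-inj-length id u sub (λ _ _ e → e)

length-cartesianProductWith : {A B C : Set} (f : A → B → C) (xs : List A) (ys : List B) →
  length (cartesianProductWith f xs ys) ≡ length xs * length ys
length-cartesianProductWith f [] ys = refl
length-cartesianProductWith f (x ∷ xs) ys =
  trans (LP.length-++ (L.map (f x) ys))
        (cong₂ _+_ (LP.length-map (f x) ys) (length-cartesianProductWith f xs ys))

length-filter-split : {A : Set} {P : A → Set} (P? : Decidable P) (xs : List A) →
  length (filter P? xs) + length (filter (¬? ∘ P?) xs) ≡ length xs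
length-filter-split P? [] = refl
length-filter-split P? (x ∷ xs) with P? x
... | yes _ = cong suc (length-filter-split P? xs)
... | no _ = trans (+-suc _ _) (cong suc (length-filter-split P? xs))

length-allFin : ∀ n → length (L.allFin n) ≡ n
length-allFin n = LP.length-tabulate id

-- The union bound. `e` plays the denominator of the estimate for each `f x`, so that the estimates
-- add up without division.
length-concatMap-≤ : {A B : Set} (f : A → List B) (xs : List A) (c e : ℕ) →
  (∀ {x} → x ∈ xs → e * length (f x) ≤ c) → e * length (concatMap f xs) ≤ length xs * c
length-concatMap-≤ f [] c e h = ≤-reflexive (*-zeroʳ e)
length-concatMap-≤ f (x ∷ xs) c e h = begin
  e * length (f x ++ concatMap f xs) ≡⟨ cong (e *_) (LP.length-++ (f x)) ⟩
  e * (length (f x) + length (concatMap f xs)) ≡⟨ *-distribˡ-+ e (length (f x)) _ ⟩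
  e * length (f x) + e * length (concatMap f xs)
    ≤⟨ +-mono-≤ (h (here refl)) (length-concatMap-≤ f xs c e (h ∘ there)) ⟩
  c + length xs * c ∎
  where open ≤-Reasoning

∈-concatMap : {A B : Set} (f : A → List B) {xs : List A} {x : A} {y : B} →
  x ∈ xs → y ∈ f x → y ∈ concatMap f xs
∈-concatMap f {xs} x∈ y∈ = ∈-concat⁺′ y∈ (∈-map⁺ f x∈)

-- Enumerations of words, increasing choices, permutations and vectors with a coincidence

vecs : {A : Set} → List A → ∀ m → List (Vec A m)
vecs xs zero = [] ∷ []
vecs xs (suc m) = cartesianProductWith _∷_ xs (vecs xs m)

length-vecs : {A : Set} (xs : List A) (m : ℕ) → length (vecs xs m) ≡ length xs ^ m
length-vecs xs zero = refl
length-vecs xs (suc m) =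
  trans (length-cartesianProductWith _∷_ xs (vecs xs m)) (cong (length xs *_) (length-vecs xs m))

∈-vecs : {A : Set} {xs : List A} {m : ℕ} (v : Vec A m) → (∀ i → V.lookup v i ∈ xs) → v ∈ vecs xs m
∈-vecs [] h = here refl
∈-vecs (x ∷ v) h = ∈-cartesianProductWith⁺ _∷_ (h zero) (∈-vecs v (h ∘ suc))

vecs-unique : {A : Set} {xs : List A} → Unique xs → ∀ m → Unique (vecs xs m)
vecs-unique u zero = [] ∷ []
vecs-unique u (suc m) = UP.cartesianProductWith⁺ _∷_ VP.∷-injective u (vecs-unique u m)

words : ∀ K m → List (Vec (Fin K) m)
words K = vecs (L.allFin K)

length-words : ∀ K m → length (words K m) ≡ K ^ m
length-words K m = trans (length-vecs (L.allFin K) m) (cong (_^ m) (length-allFin K))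

∈-words : ∀ {K m} (v : Vec (Fin K) m) → v ∈ words K m
∈-words v = ∈-vecs v (λ i → ∈-allFin _)

words-unique : ∀ K m → Unique (words K m)
words-unique K m = vecs-unique (UP.allFin⁺ K) m

-- Pascal's recursion. On `L.allFin K` the entries are the increasing vectors, and the bound K^m /
-- m! for their number is the source of every factorial gained in the proof.
combos : {A : Set} → List A → ∀ m → List (Vec A m)
combos xs zero = [] ∷ []
combos [] (suc m) = []
combos (x ∷ xs) (suc m) = L.map (x ∷_) (combos xs m) ++ combos xs (suc m)

∈-combos : {A : Set} {xs : List A} {m : ℕ} (v : Vec A m) → V.toList v ⊆ xs → v ∈ combos xs m
∈-combos [] _ = here refl
∈-combos (y ∷ v) (x ∷ʳ s) = ∈-++⁺ʳ (L.map (x ∷_) (combos _ _)) (∈-combos (y ∷ v) s)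
∈-combos (y ∷ v) (refl ∷ s) = ∈-++⁺ˡ (∈-map⁺ (y ∷_) (∈-combos v s))

-- The first two terms of the binomial expansion of (x + 1)^(m+1); they correspond to the two
-- branches of `combos`.
^-suc-lower : ∀ x m → x ^ suc m + suc m * x ^ m ≤ suc x ^ suc m
^-suc-lower x zero = ≤-reflexive (lem x)
  where
  lem : ∀ x → x * 1 + 1 ≡ suc x * 1
  lem = solve-∀
^-suc-lower x (suc m) = begin
  x ^ suc (suc m) + suc (suc m) * x ^ suc m ≡⟨ lem x m (x ^ m) ⟩
  x * (x ^ suc m + suc m * x ^ m) + (x ^ suc m + 0) ≤⟨ +-mono-≤ (*-monoʳ-≤ x (^-suc-lower x m)) (+-monoʳ-≤ (x ^ suc m) z≤n) ⟩
  x * suc x ^ suc m + (x ^ suc m + suc m * x ^ m) ≤⟨ +-monoʳ-≤ (x * suc x ^ suc m) (^-suc-lower x m) ⟩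
  x * suc x ^ suc m + suc x ^ suc m ≡⟨ +-comm (x * suc x ^ suc m) _ ⟩
  suc x ^ suc (suc m) ∎
  where
  open ≤-Reasoning
  lem : ∀ x m p → x * (x * p) + suc (suc m) * (x * p) ≡ x * (x * p + suc m * p) + (x * p + 0)
  lem = solve-∀

length-combos : {A : Set} (xs : List A) (m : ℕ) → length (combos xs m) * m ! ≤ length xs ^ m
length-combos xs zero = ≤-refl
length-combos [] (suc m) = z≤n
length-combos (x ∷ xs) (suc m) = begin
  length (L.map (x ∷_) (combos xs m) ++ combos xs (suc m)) * suc m !
    ≡⟨ cong (_* suc m !) (trans (LP.length-++ (L.map (x ∷_) (combos xs m))) (cong (_+ _) (LP.length-map _ (combos xs m)))) ⟩
  (c₁ + c₂) * (suc m * m !) ≡⟨ lem c₁ c₂ m (m !) ⟩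
  c₂ * (suc m * m !) + suc m * (c₁ * m !)
    ≤⟨ +-mono-≤ (length-combos xs (suc m)) (*-monoʳ-≤ (suc m) (length-combos xs m)) ⟩
  length xs ^ suc m + suc m * length xs ^ m ≤⟨ ^-suc-lower (length xs) m ⟩
  suc (length xs) ^ suc m ∎
  where
  open ≤-Reasoning
  c₁ = length (combos xs m)
  c₂ = length (combos xs (suc m))
  lem : ∀ a b m f → (a + b) * (suc m * f) ≡ b * (suc m * f) + suc m * (a * f)
  lem = solve-∀

inserts : {A : Set} → A → List A → List (List A)
inserts x [] = (x ∷ []) ∷ []
inserts x (y ∷ ys) = (x ∷ y ∷ ys) ∷ L.map (y ∷_) (inserts x ys)

length-inserts : {A : Set} (x : A) (ys : List A) → length (inserts x ys) ≡ suc (length ys)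
length-inserts x [] = refl
length-inserts x (y ∷ ys) = cong suc (trans (LP.length-map (y ∷_) (inserts x ys)) (length-inserts x ys))

∈-inserts : {A : Set} (x : A) (as bs : List A) → as ++ x ∷ bs ∈ inserts x (as ++ bs)
∈-inserts x [] [] = here refl
∈-inserts x [] (b ∷ bs) = here refl
∈-inserts x (a ∷ as) bs = there (∈-map⁺ (a ∷_) (∈-inserts x as bs))

perms : {A : Set} → List A → List (List A)
perms [] = [] ∷ []
perms (x ∷ xs) = concatMap (inserts x) (perms xs)

perms-length : {A : Set} (xs : List A) → All (λ ys → length ys ≡ length xs) (perms xs)
perms-length [] = refl ∷ []
perms-length (x ∷ xs) = AllP.concat⁺
  (AllP.map⁺ (All.map (λ {ys} e → All.map (λ e′ → trans e′ (cong suc e)) (ins ys)) (perms-length xs)))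
  where
  ins : ∀ ys → All (λ zs → length zs ≡ suc (length ys)) (inserts x ys)
  ins [] = refl ∷ []
  ins (y ∷ ys) = refl ∷ AllP.map⁺ (All.map (cong suc) (ins ys))

length-perms : {A : Set} (xs : List A) → length (perms xs) ≤ length xs !
length-perms [] = ≤-refl
length-perms (x ∷ xs) = begin
  length (concatMap (inserts x) (perms xs)) ≡⟨ sym (*-identityˡ _) ⟩
  1 * length (concatMap (inserts x) (perms xs))
    ≤⟨ length-concatMap-≤ (inserts x) (perms xs) (suc (length xs)) 1
         (λ {ys} p → ≤-reflexive (trans (*-identityˡ _)
           (trans (length-inserts x ys) (cong suc (All.lookup (perms-length xs) p))))) ⟩
  length (perms xs) * suc (length xs) ≤⟨ *-monoˡ-≤ (suc (length xs)) (length-perms xs) ⟩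
  length xs ! * suc (length xs) ≡⟨ *-comm (length xs !) _ ⟩
  suc (length xs) ! ∎
  where open ≤-Reasoning

∈-perms : {A : Set} {ys : List A} (xs : List A) → ys ↭ xs → ys ∈ perms xs
∈-perms [] p rewrite PP.↭-empty-inv p = here refl
∈-perms (x ∷ xs) p with ∈-∃++ (PP.∈-resp-↭ (↭-sym p) (here refl))
... | as , bs , refl = ∈-concatMap (inserts x) (∈-perms xs (PP.drop-mid as [] p)) (∈-inserts x as bs)

-- One block for each position that may hold an entry of `fs`. Vectors with several such entries may
-- be listed repeatedly, as in a union bound.
touching : {A : Set} → List A → List A → ∀ m → List (Vec A m)
touching as fs zero = []
touching as fs (suc m) = cartesianProductWith _∷_ fs (vecs as m) ++ cartesianProductWith _∷_ as (touching as fs m)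

∈-touching : {A : Set} {as fs : List A} {m : ℕ} (v : Vec A m) → (∀ i → V.lookup v i ∈ as) →
  ∀ i → V.lookup v i ∈ fs → v ∈ touching as fs m
∈-touching (x ∷ v) h zero x∈ = ∈-++⁺ˡ (∈-cartesianProductWith⁺ _∷_ x∈ (∈-vecs v (h ∘ suc)))
∈-touching {as = as} {fs} (x ∷ v) h (suc i) p =
  ∈-++⁺ʳ (cartesianProductWith _∷_ fs (vecs as _)) (∈-cartesianProductWith⁺ _∷_ (h zero) (∈-touching v (h ∘ suc) i p))

-- The size is m |fs| |as|^(m-1); the factor `length as` avoids the exponent m - 1.
length-touching : {A : Set} (as fs : List A) (m : ℕ) →
  length as * length (touching as fs m) ≡ m * length fs * length as ^ m
length-touching as fs zero = *-zeroʳ (length as)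
length-touching as fs (suc m) = begin
  a * length (touching as fs (suc m)) ≡⟨ cong (a *_) (LP.length-++ (cartesianProductWith _∷_ fs (vecs as m))) ⟩
  a * (length (cartesianProductWith _∷_ fs (vecs as m)) + length (cartesianProductWith _∷_ as (touching as fs m)))
    ≡⟨ cong (a *_) (cong₂ _+_
        (trans (length-cartesianProductWith _∷_ fs (vecs as m)) (cong (f *_) (length-vecs as m)))
        (trans (length-cartesianProductWith _∷_ as (touching as fs m)) (length-touching as fs m))) ⟩
  a * (f * a ^ m + m * f * a ^ m) ≡⟨ lem a f m (a ^ m) ⟩
  suc m * f * (a * a ^ m) ∎
  where
  open ≡-Reasoning
  a = length as
  f = length fs
  lem : ∀ a f m p → a * (f * p + m * f * p) ≡ suc m * f * (a * p)
  lem = solve-∀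

repeating : {A : Set} → List A → ∀ m → List (Vec A m)
repeating as zero = []
repeating as (suc m) = concatMap (λ v → L.map (_∷ v) (V.toList v)) (vecs as m) ++ cartesianProductWith _∷_ as (repeating as m)

uniqueVec? : ∀ {K m} (v : Vec (Fin K) m) → Dec (VU.Unique v)
uniqueVec? = VAP.allPairs? (λ x y → ¬? (x FP.≟ y))

lookup∈toList : {A : Set} {m : ℕ} (v : Vec A m) (i : Fin m) → V.lookup v i ∈ V.toList v
lookup∈toList (x ∷ v) zero = here refl
lookup∈toList (x ∷ v) (suc i) = there (lookup∈toList v i)

∈toList⇒lookup : {A : Set} {m : ℕ} {y : A} (v : Vec A m) → y ∈ V.toList v → ∃ λ i → V.lookup v i ≡ y
∈toList⇒lookup (x ∷ v) (here e) = zero , sym e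
∈toList⇒lookup (x ∷ v) (there p) with ∈toList⇒lookup v p
... | i , e = suc i , e

∈-repeating : ∀ {K m} (v : Vec (Fin K) m) → ¬ VU.Unique v → v ∈ repeating (L.allFin K) m
∈-repeating [] ¬u = ⊥-elim (¬u VAP.[])
∈-repeating {K} {suc m} (x ∷ v) ¬u with Any.any? (x FP.≟_) (V.toList v)
... | yes x∈ = ∈-++⁺ˡ (∈-concatMap (λ w → L.map (_∷ w) (V.toList w)) (∈-words v) (∈-map⁺ (_∷ v) x∈))
... | no x∉ with uniqueVec? v
...   | no ¬uv = ∈-++⁺ʳ (concatMap (λ w → L.map (_∷ w) (V.toList w)) (words K m))
                   (∈-cartesianProductWith⁺ _∷_ (∈-allFin x) (∈-repeating v ¬uv))
...   | yes uv = ⊥-elim (¬u (fresh v x∉ VAP.∷ uv))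
  where
  fresh : ∀ {m} (w : Vec (Fin K) m) → x ∉ V.toList w → VA.All (λ y → ¬ x ≡ y) w
  fresh [] _ = VA.[]
  fresh (y ∷ w) n = (λ e → n (here e)) VA.∷ fresh w (n ∘ there)

-- Birthday bound: at most m² pairs of positions can coincide, each with probability 1 / |as|.
length-repeating : {A : Set} (as : List A) (m : ℕ) →
  length as * length (repeating as m) ≤ m ^ 2 * length as ^ m
length-repeating as zero = ≤-reflexive (*-zeroʳ (length as))
length-repeating as (suc m) = begin
  a * length (repeating as (suc m)) ≡⟨ cong (a *_) (LP.length-++ first) ⟩
  a * (length first + length second)
    ≤⟨ *-monoʳ-≤ a (+-mono-≤ bound₁ (≤-reflexive (length-cartesianProductWith _∷_ as (repeating as m)))) ⟩
  a * (a ^ m * m + a * length (repeating as m)) ≤⟨ *-monoʳ-≤ a (+-monoʳ-≤ (a ^ m * m) (length-repeating as m)) ⟩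
  a * (a ^ m * m + m ^ 2 * a ^ m) ≤⟨ m≤m+n _ (suc m * (a * a ^ m)) ⟩
  a * (a ^ m * m + m ^ 2 * a ^ m) + suc m * (a * a ^ m) ≡⟨ lem a m (a ^ m) ⟩
  suc m ^ 2 * (a * a ^ m) ∎
  where
  open ≤-Reasoning
  a = length as
  first = concatMap (λ v → L.map (_∷ v) (V.toList v)) (vecs as m)
  second = cartesianProductWith _∷_ as (repeating as m)
  bound₁ : length first ≤ a ^ m * m
  bound₁ = subst₂ _≤_ (*-identityˡ _) (cong (_* m) (length-vecs as m))
    (length-concatMap-≤ (λ v → L.map (_∷ v) (V.toList v)) (vecs as m) m 1
      (λ {v} _ → ≤-reflexive (trans (*-identityˡ _) (trans (LP.length-map _ (V.toList v)) (VP.length-toList v)))))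
  lem : ∀ a m p → a * (p * m + m * (m * 1) * p) + suc m * (a * p) ≡ suc m * (suc m * 1) * (a * p)
  lem = solve-∀

concatMap-[] : {A B : Set} (f : A → List B) (xs : List A) → (∀ x → f x ≡ []) → concatMap f xs ≡ []
concatMap-[] f [] h = refl
concatMap-[] f (x ∷ xs) h rewrite h x = concatMap-[] f xs h

-- One step of the potential argument: an element with `P` costs the full weight `w`, any other
-- element half of it. In `Game`, `P` holds for the moves that do not raise the score.
length-concatMap-split : {A B : Set} {P : A → Set} (P? : Decidable P) (f : A → List B) (e w : ℕ) (xs : List A) →
  (∀ x → P x → e * length (f x) ≤ w) → (∀ x → ¬ P x → 2 * (e * length (f x)) ≤ w) →
  2 * (e * length (concatMap f xs)) ≤ w * (length xs + length (filter P? xs))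
length-concatMap-split P? f e w [] h h′ = ≤-trans (≤-reflexive (cong (2 *_) (*-zeroʳ e))) z≤n
length-concatMap-split P? f e w (x ∷ xs) h h′ rewrite LP.length-++ (f x) {concatMap f xs} with P? x
... | yes p = begin
  2 * (e * (l + l′)) ≡⟨ lem e l l′ ⟩
  2 * (e * l) + 2 * (e * l′) ≤⟨ +-mono-≤ (*-monoʳ-≤ 2 (h x p)) (length-concatMap-split P? f e w xs h h′) ⟩
  2 * w + w * (n + n′) ≡⟨ lem₂ w n n′ ⟩
  w * (suc n + suc n′) ∎
  where
  open ≤-Reasoning
  l = length (f x)
  l′ = length (concatMap f xs)
  n = length xs
  n′ = length (filter P? xs)
  lem : ∀ e l l′ → 2 * (e * (l + l′)) ≡ 2 * (e * l) + 2 * (e * l′)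
  lem = solve-∀
  lem₂ : ∀ w n n′ → 2 * w + w * (n + n′) ≡ w * (suc n + suc n′)
  lem₂ = solve-∀
... | no ¬p = begin
  2 * (e * (l + l′)) ≡⟨ lem e l l′ ⟩
  2 * (e * l) + 2 * (e * l′) ≤⟨ +-mono-≤ (h′ x ¬p) (length-concatMap-split P? f e w xs h h′) ⟩
  w + w * (n + n′) ≡⟨ lem₂ w n n′ ⟩
  w * (suc n + n′) ∎
  where
  open ≤-Reasoning
  l = length (f x)
  l′ = length (concatMap f xs)
  n = length xs
  n′ = length (filter P? xs)
  lem : ∀ e l l′ → 2 * (e * (l + l′)) ≡ 2 * (e * l) + 2 * (e * l′)
  lem = solve-∀
  lem₂ : ∀ w n n′ → w + w * (n + n′) ≡ w * (suc n + n′)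
  lem₂ = solve-∀

-- Integer forms of lower bounds for powers of 1 + 1/b

-- Bernoulli's inequality (1 + 1/b)^m ≥ 1 + m/b, multiplied by b^(m+1).
bernoulli : ∀ b m → b ^ m * (b + m) ≤ suc b ^ m * b
bernoulli b zero = ≤-reflexive (cong (1 *_) (+-identityʳ b))
bernoulli b (suc m) = begin
  b * b ^ m * (b + suc m) ≤⟨ m≤m+n _ (b ^ m * m) ⟩
  b * b ^ m * (b + suc m) + b ^ m * m ≡⟨ lem b m (b ^ m) ⟩
  suc b * (b ^ m * (b + m)) ≤⟨ *-monoʳ-≤ (suc b) (bernoulli b m) ⟩
  suc b * (suc b ^ m * b) ≡⟨ sym (*-assoc (suc b) (suc b ^ m) b) ⟩
  suc b * suc b ^ m * b ∎
  where
  open ≤-Reasoning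
  lem : ∀ b m p → b * p * (b + suc m) + p * m ≡ suc b * (p * (b + m))
  lem = solve-∀

-- Bernoulli with exponent b + 1, as 1 + (b + 1)/b exceeds 2. A decay by b / (1 + b) per step thus
-- halves a quantity within 1 + b steps.
^-double : ∀ b → 1 ≤ b → 2 * b ^ suc b ≤ suc b ^ suc b
^-double b@(suc _) _ = *-cancelʳ-≤ _ _ b (begin
  2 * b ^ suc b * b ≤⟨ m≤m+n _ (b ^ suc b) ⟩
  2 * b ^ suc b * b + b ^ suc b ≡⟨ lem b (b ^ suc b) ⟩
  b ^ suc b * (b + suc b) ≤⟨ bernoulli b (suc b) ⟩
  suc b ^ suc b * b ∎)
  where
  open ≤-Reasoning
  lem : ∀ b p → 2 * p * b + p ≡ p * (b + suc b)
  lem = solve-∀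

^-double-iter : ∀ b y z → 1 ≤ b → 2 ^ y * b ^ (suc b * y + z) ≤ suc b ^ (suc b * y + z)
^-double-iter b zero z 1≤b rewrite *-zeroʳ b =
  ≤-trans (≤-reflexive (*-identityˡ _)) (^-monoˡ-≤ z (n≤1+n b))
^-double-iter b (suc y) z 1≤b = begin
  2 * 2 ^ y * b ^ (suc b * suc y + z) ≡⟨ cong (2 * 2 ^ y *_) (split b) ⟩
  2 * 2 ^ y * (b ^ suc b * b ^ (suc b * y + z)) ≡⟨ lem (2 ^ y) (b ^ suc b) _ ⟩
  2 * b ^ suc b * (2 ^ y * b ^ (suc b * y + z)) ≤⟨ *-mono-≤ (^-double b 1≤b) (^-double-iter b y z 1≤b) ⟩
  suc b ^ suc b * suc b ^ (suc b * y + z) ≡⟨ sym (split (suc b)) ⟩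
  suc b ^ (suc b * suc y + z) ∎
  where
  open ≤-Reasoning
  split : ∀ x → x ^ (suc b * suc y + z) ≡ x ^ suc b * x ^ (suc b * y + z)
  split x = trans (cong (x ^_) (trans (cong (_+ z) (*-suc (suc b) y)) (+-assoc (suc b) _ z))) (^-distribˡ-+-* x (suc b) _)
  lem : ∀ p c d → 2 * p * (c * d) ≡ 2 * c * (p * d)
  lem = solve-∀

^-distribʳ-* : ∀ x y m → (x * y) ^ m ≡ x ^ m * y ^ m
^-distribʳ-* x y zero = refl
^-distribʳ-* x y (suc m) = trans (cong (x * y *_) (^-distribʳ-* x y m)) (lem x y (x ^ m) (y ^ m))
  where
  lem : ∀ x y p r → x * y * (p * r) ≡ x * p * (y * r)
  lem = solve-∀

-- Tail bound for sequential games with uniform moves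

module Game {A St : Set} (as : List A) (step : St → A → St) (score : St → ℕ) (target : ℕ) where

  run : ∀ {m} → St → Vec A m → St
  run s [] = s
  run s (a ∷ v) = run (step s a) v

  -- Divided by |as|^m, its length is the probability that m independent uniform moves from `s` end
  -- below the target.
  losing : ∀ m → St → List (Vec A m)
  losing zero s with score s <? target
  ... | yes _ = [] ∷ []
  ... | no _ = []
  losing (suc m) s = concatMap (λ a → L.map (a ∷_) (losing m (step s a))) as

  ∈-losing : ∀ {m} s (v : Vec A m) → (∀ i → V.lookup v i ∈ as) → score (run s v) < target → v ∈ losing m s
  ∈-losing s [] h lt with score s <? target
  ... | yes _ = here refl
  ... | no ¬lt = ⊥-elim (¬lt lt)
  ∈-losing s (a ∷ v) h lt =
    ∈-concatMap (λ x → L.map (x ∷_) (losing _ (step s x))) (h zero) (∈-map⁺ (a ∷_) (∈-losing (step s a) v (h ∘ suc) lt))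

  module _ (score-mono : ∀ s a → score s ≤ score (step s a)) where

    losing-[] : ∀ m s → target ≤ score s → losing m s ≡ []
    losing-[] zero s le with score s <? target
    ... | yes lt = ⊥-elim (<⇒≱ lt le)
    ... | no _ = refl
    losing-[] (suc m) s le = concatMap-[] _ as
      (λ a → cong (L.map (a ∷_)) (losing-[] m (step s a) (≤-trans le (score-mono s a))))

    -- `progress` says that below the target a move raises the score with probability at least 1 /
    -- q. Such a move at least halves the potential, so the mean factor per move is at most 1 -
    -- 1/(2q) = b / (1 + b).
    module _ (Inv : St → Set) (inv-step : ∀ s a → Inv s → Inv (step s a)) (q b : ℕ) (2q≡1+b : 2 * q ≡ suc b)
      (progress : ∀ s → Inv s → score s < target →
        q * length (filter (λ a → score (step s a) ≤? score s) as) + length as ≤ q * length as) where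

      -- The expectation of 2 ^ (target - score) shrinks by the factor b / (1 + b) in every step.
      losing-potential : ∀ m s → Inv s →
        suc b ^ m * 2 ^ score s * length (losing m s) ≤ 2 ^ target * (b * length as) ^ m
      losing-potential m s inv with target ≤? score s
      -- `progress` is silent past the target, but the score never drops, so no losing continuation
      -- is left there.
      losing-potential m s inv | yes le rewrite losing-[] m s le | *-zeroʳ (suc b ^ m * 2 ^ score s) = z≤n
      losing-potential zero s inv | no ¬le with score s <? target
      ... | yes lt = begin
        1 * 2 ^ score s * 1 ≡⟨ lem (2 ^ score s) ⟩
        2 ^ score s * 1 ≤⟨ *-monoˡ-≤ 1 (^-monoʳ-≤ 2 (<⇒≤ lt)) ⟩
        2 ^ target * 1 ∎
        where
        open ≤-Reasoning
        lem : ∀ x → 1 * x * 1 ≡ x * 1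
        lem = solve-∀
      ... | no ¬lt = ⊥-elim (¬le (≮⇒≥ ¬lt))
      losing-potential (suc m) s inv | no ¬le = *-cancelˡ-≤ 2 (begin
        2 * (c * c ^ m * 2 ^ score s * X) ≡⟨ lem₁ c (c ^ m) (2 ^ score s) X ⟩
        c * (2 * (e * X)) ≤⟨ *-monoʳ-≤ c (length-concatMap-split (λ a → score (step s a) ≤? score s)
          (λ a → L.map (a ∷_) (losing m (step s a))) e W as bad good) ⟩
        c * (W * (n + n′)) ≡⟨ cong (λ z → z * (W * (n + n′))) (sym 2q≡1+b) ⟩
        2 * q * (W * (n + n′)) ≡⟨ lem₂ q W n n′ ⟩
        2 * W * (q * n + q * n′) ≤⟨ *-monoʳ-≤ (2 * W) key ⟩
        2 * W * (b * n) ≡⟨ lem₃ (2 ^ target) (b * n) ((b * n) ^ m) ⟩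
        2 * (2 ^ target * (b * n * (b * n) ^ m)) ∎)
        where
        open ≤-Reasoning
        c = suc b
        e = c ^ m * 2 ^ score s
        X = length (losing (suc m) s)
        W = 2 ^ target * (b * length as) ^ m
        n = length as
        n′ = length (filter (λ a → score (step s a) ≤? score s) as)
        lem₁ : ∀ c p u X → 2 * (c * p * u * X) ≡ c * (2 * (p * u * X))
        lem₁ = solve-∀
        lem₂ : ∀ q W n n′ → 2 * q * (W * (n + n′)) ≡ 2 * W * (q * n + q * n′)
        lem₂ = solve-∀
        lem₃ : ∀ t x p → 2 * (t * p) * x ≡ 2 * (t * (x * p))
        lem₃ = solve-∀
        key : q * n + q * n′ ≤ b * n
        key = +-cancelʳ-≤ n _ _ (begin
          q * n + q * n′ + n ≡⟨ +-assoc (q * n) _ n ⟩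
          q * n + (q * n′ + n) ≤⟨ +-monoʳ-≤ (q * n) (progress s inv (≰⇒> ¬le)) ⟩
          q * n + q * n ≡⟨ lem₄ q n ⟩
          2 * q * n ≡⟨ cong (_* n) 2q≡1+b ⟩
          n + b * n ≡⟨ +-comm n _ ⟩
          b * n + n ∎)
          where
          lem₄ : ∀ q n → q * n + q * n ≡ 2 * q * n
          lem₄ = solve-∀
        bad : ∀ a → score (step s a) ≤ score s → e * length (L.map (a ∷_) (losing m (step s a))) ≤ W
        bad a _ = begin
          e * length (L.map (a ∷_) (losing m (step s a))) ≡⟨ cong (e *_) (LP.length-map (a ∷_) (losing m (step s a))) ⟩
          c ^ m * 2 ^ score s * length (losing m (step s a))
            ≤⟨ *-monoˡ-≤ _ (*-monoʳ-≤ (c ^ m) (^-monoʳ-≤ 2 (score-mono s a))) ⟩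
          c ^ m * 2 ^ score (step s a) * length (losing m (step s a)) ≤⟨ losing-potential m (step s a) (inv-step s a inv) ⟩
          W ∎
        good : ∀ a → ¬ (score (step s a) ≤ score s) → 2 * (e * length (L.map (a ∷_) (losing m (step s a)))) ≤ W
        good a ¬p = begin
          2 * (e * length (L.map (a ∷_) (losing m (step s a)))) ≡⟨ cong (λ z → 2 * (e * z))
            (LP.length-map (a ∷_) (losing m (step s a))) ⟩
          2 * (c ^ m * 2 ^ score s * length (losing m (step s a))) ≡⟨ lem₅ (c ^ m) (2 ^ score s) _ ⟩
          c ^ m * 2 ^ suc (score s) * length (losing m (step s a))
            ≤⟨ *-monoˡ-≤ _ (*-monoʳ-≤ (c ^ m) (^-monoʳ-≤ 2 (≰⇒> ¬p))) ⟩
          c ^ m * 2 ^ score (step s a) * length (losing m (step s a)) ≤⟨ losing-potential m (step s a) (inv-step s a inv) ⟩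
          W ∎
          where
          lem₅ : ∀ p u X → 2 * (p * u * X) ≡ p * (2 * u) * X
          lem₅ = solve-∀

      -- Every 2q = 1 + b moves halve the expected potential; target + k such rounds repay the
      -- initial 2^target and leave failure probability 2^-k.
      length-losing : ∀ k m s → Inv s → 2 * q * (target + k) ≤ m → 1 ≤ q →
        2 ^ k * length (losing m s) ≤ length as ^ m
      length-losing k m s inv le 1≤q = *-cancelˡ-≤ (2 ^ target * b ^ m) (begin
        2 ^ target * b ^ m * (2 ^ k * X) ≡⟨ lem (2 ^ target) (b ^ m) (2 ^ k) X ⟩
        2 ^ target * 2 ^ k * b ^ m * X ≡⟨ cong (λ z → z * b ^ m * X) (sym (^-distribˡ-+-* 2 target k)) ⟩
        2 ^ (target + k) * b ^ m * X ≤⟨ *-monoˡ-≤ X pow ⟩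
        suc b ^ m * X ≤⟨ *-monoˡ-≤ X (m≤m*n (suc b ^ m) (2 ^ score s)) ⟩
        suc b ^ m * 2 ^ score s * X ≤⟨ losing-potential m s inv ⟩
        2 ^ target * (b * length as) ^ m ≡⟨ cong (2 ^ target *_) (^-distribʳ-* b (length as) m) ⟩
        2 ^ target * (b ^ m * length as ^ m) ≡⟨ sym (*-assoc (2 ^ target) _ _) ⟩
        2 ^ target * b ^ m * length as ^ m ∎)
        where
        open ≤-Reasoning
        X = length (losing m s)
        1≤b : 1 ≤ b
        1≤b = s≤s⁻¹ (subst (2 ≤_) 2q≡1+b (*-monoʳ-≤ 2 1≤q))
        instance
          b≢0 : NonZero b
          b≢0 = >-nonZero 1≤b
          score≢0 : NonZero (2 ^ score s)
          score≢0 = m^n≢0 2 (score s)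
          target≢0 : NonZero (2 ^ target)
          target≢0 = m^n≢0 2 target
          b^m≢0 : NonZero (b ^ m)
          b^m≢0 = m^n≢0 b m
          prod≢0 : NonZero (2 ^ target * b ^ m)
          prod≢0 = m*n≢0 (2 ^ target) (b ^ m)
        lem : ∀ t p u X → t * p * (u * X) ≡ t * u * p * X
        lem = solve-∀
        m≡ : suc b * (target + k) + (m ∸ suc b * (target + k)) ≡ m
        m≡ = m+[n∸m]≡n (subst (λ z → z * (target + k) ≤ m) 2q≡1+b le)
        pow : 2 ^ (target + k) * b ^ m ≤ suc b ^ m
        pow = subst (λ z → 2 ^ (target + k) * b ^ z ≤ suc b ^ z) m≡
                (^-double-iter b (target + k) (m ∸ suc b * (target + k)) 1≤b)

-- Boxes: greedy collection, then greedy matching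

occ : ∀ {N} → Fin N → List (Fin N) → ℕ
occ i us = length (filter (i FP.≟_) us)

occ-++ : ∀ {N} (i : Fin N) us vs → occ i (us ++ vs) ≡ occ i us + occ i vs
occ-++ i us vs = trans (cong length (LP.filter-++ (i FP.≟_) us vs)) (LP.length-++ (filter (i FP.≟_) us))

occ-remove : ∀ {N} {i j : Fin N} → i ≢ j → ∀ us → occ j (filter (¬? ∘ (i FP.≟_)) us) ≡ occ j us
occ-remove i≢j [] = refl
occ-remove {i = i} {j} i≢j (u ∷ us) with i FP.≟ u
... | yes refl rewrite LP.filter-reject (j FP.≟_) {i} {us} (i≢j ∘ sym) = occ-remove i≢j us
... | no _ with j FP.≟ u
...   | yes _ = cong suc (occ-remove i≢j us)
...   | no _ = occ-remove i≢j us

-- Double counting: different members of `is` occupy disjoint parts of `us`, removed one member at a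
-- time. It will bound the number of intervals of full degree.
occ-sum : ∀ {N} (d : ℕ) {is : List (Fin N)} (us : List (Fin N)) → Unique is →
  (∀ {i} → i ∈ is → d ≤ occ i us) → d * length is ≤ length us
occ-sum d {[]} us _ _ = ≤-trans (≤-reflexive (*-zeroʳ d)) z≤n
occ-sum d {i ∷ is} us (i∉ ∷ u) h = begin
  d * suc (length is) ≡⟨ *-suc d (length is) ⟩
  d + d * length is ≤⟨ +-mono-≤ (h (here refl)) (occ-sum d us′ u h′) ⟩
  occ i us + length us′ ≡⟨ length-filter-split (i FP.≟_) us ⟩
  length us ∎
  where
  open ≤-Reasoning
  us′ = filter (¬? ∘ (i FP.≟_)) us
  h′ : ∀ {j} → j ∈ is → d ≤ occ j us′
  h′ j∈ = ≤-trans (h (there j∈)) (≤-reflexive (sym (occ-remove (All.lookup i∉ j∈) us)))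

occ-absent : ∀ {N} {i : Fin N} {us} → i ∉ us → occ i us ≡ 0
occ-absent {i = i} {us} i∉ = cong length (LP.filter-none (i FP.≟_) (AllP.¬Any⇒All¬ us i∉))

occ-unique : ∀ {N m} (i : Fin N) {b : Vec (Fin N) m} → VU.Unique b → occ i (V.toList b) ≤ 1
occ-unique i {[]} _ = z≤n
occ-unique i {x ∷ b} (x∉ VAP.∷ u) with i FP.≟ x
... | yes refl = s≤s (≤-reflexive (occ-absent (absent x∉)))
  where
  absent : ∀ {m} {w : Vec (Fin _) m} → VA.All (x ≢_) w → x ∉ V.toList w
  absent (x≢ VA.∷ _) (here e) = x≢ e
  absent (_ VA.∷ h) (there p) = absent h p
... | no _ = occ-unique i u

occ-member : ∀ {N} {i : Fin N} {us} → i ∈ us → 1 ≤ occ i us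
occ-member {i = i} i∈ = ∈-length (∈-filter⁺ (i FP.≟_) i∈ refl)

module Boxes (N r : ℕ) where

  Box : Set
  Box = Vec (Fin N) r

  boxes : List Box
  boxes = words N r

  infix 4 _∈ᵇ?_
  _∈ᵇ?_ : (b : Box) (D : List Box) → Dec (b ∈ D)
  b ∈ᵇ? D = Any.any? (VP.≡-dec FP._≟_ b) D

  -- A collection of boxes is treated as a hypergraph on the N intervals: `occ i (flat D)` is the
  -- degree of `i`, with multiplicity.
  flat : List Box → List (Fin N)
  flat = concatMap V.toList

  length-flat : ∀ D → length (flat D) ≡ r * length D
  length-flat [] = sym (*-zeroʳ r)
  length-flat (b ∷ D) = trans (LP.length-++ (V.toList b))
    (trans (cong₂ _+_ (VP.length-toList b) (length-flat D)) (sym (*-suc r (length D))))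

  Disjoint : Box → Box → Set
  Disjoint b c = ∀ s s′ → V.lookup b s ≢ V.lookup c s′

  Touches : List (Fin N) → Box → Set
  Touches us b = Any (λ i → i ∈ V.toList b) us

  _∈ᵛ?_ : (i : Fin N) (b : Box) → Dec (i ∈ V.toList b)
  i ∈ᵛ? b = Any.any? (i FP.≟_) (V.toList b)

  touches? : ∀ us (b : Box) → Dec (Touches us b)
  touches? us b = Any.any? (_∈ᵛ? b) us

  length-containing : ∀ i D → length (filter (i ∈ᵛ?_) D) ≤ occ i (flat D)
  length-containing i [] = z≤n
  length-containing i (b ∷ D) rewrite occ-++ i (V.toList b) (flat D) with i ∈ᵛ? b
  ... | yes i∈ = +-mono-≤ (occ-member i∈) (length-containing i D)
  ... | no _ = ≤-trans (length-containing i D) (m≤n+m _ _)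

  length-touches-∷ : ∀ i us D → length (filter (touches? (i ∷ us)) D) ≤
    length (filter (i ∈ᵛ?_) D) + length (filter (touches? us) D)
  length-touches-∷ i us [] = z≤n
  length-touches-∷ i us (b ∷ D) with i ∈ᵛ? b | touches? us b
  ... | yes _ | yes _ = s≤s (≤-trans (length-touches-∷ i us D) (+-monoʳ-≤ _ (n≤1+n _)))
  ... | yes _ | no _ = s≤s (length-touches-∷ i us D)
  ... | no _ | yes _ = ≤-trans (s≤s (length-touches-∷ i us D)) (≤-reflexive (sym (+-suc _ _)))
  ... | no _ | no _ = length-touches-∷ i us D

  length-touches : ∀ d us D → (∀ i → occ i (flat D) ≤ d) → length (filter (touches? us) D) ≤ length us * d
  length-touches d [] D h = ≤-reflexive (cong length (LP.filter-none (touches? []) (All.universal (λ _ ()) D)))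
  length-touches d (i ∷ us) D h = ≤-trans (length-touches-∷ i us D)
    (+-mono-≤ (≤-trans (length-containing i D) (h i)) (length-touches d us D h))

  -- The degree cap d ensures that boxes already matched block only a small part of the collection.
  module Collect (d : ℕ) where

    -- Distinct entries let the intervals alone fix the order of the labels within an edge. The
    -- second clause keeps degrees at most `d` once `b` is added. Novelty lets `D` be counted as a
    -- set of targets in the second phase.
    Admissible : List Box → Box → Set
    Admissible D b = VU.Unique b × (∀ s → suc (occ (V.lookup b s) (flat D)) ≤ d) × b ∉ D

    admissible? : ∀ D b → Dec (Admissible D b)
    admissible? D b = uniqueVec? b ×-dec (FP.all? (λ s → suc (occ (V.lookup b s) (flat D)) ≤? d) ×-dec ¬? (b ∈ᵇ? D))

    step : List Box → Box → List Box
    step D b with admissible? D b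
    ... | yes _ = b ∷ D
    ... | no _ = D

    record Inv (D : List Box) : Set where
      constructor inv
      field
        distinct : Unique D
        injective : All VU.Unique D
        degree : ∀ i → occ i (flat D) ≤ d

    step-mono : ∀ D b → length D ≤ length (step D b)
    step-mono D b with admissible? D b
    ... | yes _ = n≤1+n _
    ... | no _ = ≤-refl

    inv-step : ∀ D b → Inv D → Inv (step D b)
    inv-step D b I with admissible? D b
    ... | no _ = I
    ... | yes (u , deg , b∉) = inv (AllP.¬Any⇒All¬ D b∉ ∷ Inv.distinct I) (u ∷ Inv.injective I) degree′
      where
      degree′ : ∀ i → occ i (flat (b ∷ D)) ≤ d
      degree′ i rewrite occ-++ i (V.toList b) (flat D) with i ∈ᵛ? b
      ... | no i∉ rewrite occ-absent i∉ = Inv.degree I i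
      ... | yes i∈ with ∈toList⇒lookup b i∈
      ...   | s , refl = ≤-trans (+-monoˡ-≤ _ (occ-unique (V.lookup b s) u)) (deg s)

    module G = Game boxes step length

    run-members : ∀ {m} h D (v : Vec Box m) {b} → b ∈ G.run h D v → b ∈ D ⊎ (∃ λ i → V.lookup v i ≡ b)
    run-members h D [] b∈ = inj₁ b∈
    run-members h D (c ∷ v) b∈ with run-members h (step D c) v b∈
    ... | inj₂ (i , e) = inj₂ (suc i , e)
    ... | inj₁ p with admissible? D c
    ...   | no _ = inj₁ p
    run-members h D (c ∷ v) b∈ | inj₁ (here e) | yes _ = inj₂ (zero , sym e)
    run-members h D (c ∷ v) b∈ | inj₁ (there p) | yes _ = inj₁ p

    run-inv : ∀ {m} h D (v : Vec Box m) → Inv D → Inv (G.run h D v)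
    run-inv h D [] I = I
    run-inv h D (c ∷ v) I = run-inv h (step D c) v (inv-step D c I)

    module _ (h : ℕ) (1≤d : 1 ≤ d) (1≤N : 1 ≤ N) (N-large : 8 * (r * r) ≤ N) (d-large : 8 * (r * r) * h ≤ d * N)
      (h-small : 4 * h ≤ N ^ r) where

      inadmissible : List Box → List Box
      inadmissible D = repeating (L.allFin N) r ++ D ++ touching (L.allFin N) (filter (λ i → d ≤? occ i (flat D)) (L.allFin N)) r

      ∈-inadmissible : ∀ D b → ¬ Admissible D b → b ∈ inadmissible D
      ∈-inadmissible D b ¬a with uniqueVec? b
      ... | no ¬u = ∈-++⁺ˡ (∈-repeating b ¬u)
      ... | yes u with b ∈ᵇ? D
      ...   | yes b∈ = ∈-++⁺ʳ (repeating (L.allFin N) r) (∈-++⁺ˡ b∈)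
      ...   | no b∉ with FP.any? (λ s → d ≤? occ (V.lookup b s) (flat D))
      ...     | yes (s , le) = ∈-++⁺ʳ (repeating (L.allFin N) r) (∈-++⁺ʳ D
                  (∈-touching b (λ _ → ∈-allFin _) s (∈-filter⁺ (λ i → d ≤? occ i (flat D)) (∈-allFin _) le)))
      ...     | no ¬full = ⊥-elim (¬a (u , (λ s → ≰⇒> (λ le → ¬full (s , le))) , b∉))

      -- The three causes exclude at most 1/8 (repeated entry), 1/4 (already in `D`) and 1/8 (entry
      -- of full degree) of all boxes, together at most half. The factor 4N clears the denominators.
      length-inadmissible : ∀ D → length D < h → 2 * length (inadmissible D) ≤ N ^ r
      length-inadmissible D D<h = *-cancelˡ-≤ (4 * N) (begin
        4 * N * (2 * length (inadmissible D))
          ≡⟨ cong (λ z → 4 * N * (2 * z)) (trans (LP.length-++ reps) (cong (length reps +_) (LP.length-++ D))) ⟩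
        4 * N * (2 * (length reps + (length D + length touch))) ≡⟨ lem₁ N (length reps) (length D) (length touch) ⟩
        8 * (N * length reps) + 2 * (N * (4 * length D)) + 8 * (N * length touch)
          ≤⟨ +-mono-≤ (+-mono-≤ b₁ b₂) (≤-trans (≤-reflexive b₃) b₄) ⟩
        N * N ^ r + 2 * (N * N ^ r) + N * N ^ r ≡⟨ lem₂ N (N ^ r) ⟩
        4 * N * N ^ r ∎)
        where
        open ≤-Reasoning
        instance
          N≢0 : NonZero N
          N≢0 = >-nonZero 1≤N
          d≢0 : NonZero d
          d≢0 = >-nonZero 1≤d
          4N≢0 : NonZero (4 * N)
          4N≢0 = m*n≢0 4 N
        reps = repeating (L.allFin N) r
        full = filter (λ i → d ≤? occ i (flat D)) (L.allFin N)
        touch = touching (L.allFin N) full r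
        lem₁ : ∀ N a b c → 4 * N * (2 * (a + (b + c))) ≡ 8 * (N * a) + 2 * (N * (4 * b)) + 8 * (N * c)
        lem₁ = solve-∀
        lem₂ : ∀ N p → N * p + 2 * (N * p) + N * p ≡ 4 * N * p
        lem₂ = solve-∀
        b₁ : 8 * (N * length reps) ≤ N * N ^ r
        b₁ = begin
          8 * (N * length reps) ≤⟨ *-monoʳ-≤ 8 (subst (λ z → z * length reps ≤ r ^ 2 * z ^ r) (length-allFin N)
            (length-repeating (L.allFin N) r)) ⟩
          8 * (r ^ 2 * N ^ r) ≡⟨ lem r (N ^ r) ⟩
          8 * (r * r) * N ^ r ≤⟨ *-monoˡ-≤ (N ^ r) N-large ⟩
          N * N ^ r ∎
          where
          lem : ∀ r p → 8 * (r * (r * 1) * p) ≡ 8 * (r * r) * p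
          lem = solve-∀
        b₂ : 2 * (N * (4 * length D)) ≤ 2 * (N * N ^ r)
        b₂ = *-monoʳ-≤ 2 (*-monoʳ-≤ N (≤-trans (*-monoʳ-≤ 4 (<⇒≤ D<h)) h-small))
        b₃ : 8 * (N * length touch) ≡ 8 * (r * length full) * N ^ r
        b₃ = trans (cong (8 *_) (subst (λ z → z * length touch ≡ r * length full * z ^ r) (length-allFin N)
          (length-touching (L.allFin N) full r)))
                   (sym (*-assoc 8 (r * length full) (N ^ r)))
        -- Each full interval takes at least d of the r |D| incidences, so d |full| ≤ r h, and
        -- `d-large` converts this.
        full-bound : 8 * (r * length full) ≤ N
        full-bound = *-cancelˡ-≤ d (begin
          d * (8 * (r * length full)) ≡⟨ lem₃ d r (length full) ⟩
          8 * r * (d * length full)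
            ≤⟨ *-monoʳ-≤ (8 * r) (occ-sum d (flat D) (UP.filter⁺ (λ i → d ≤? occ i (flat D)) (UP.allFin⁺ N))
                 (λ i∈ → proj₂ (∈-filter⁻ (λ i → d ≤? occ i (flat D)) {xs = L.allFin N} i∈))) ⟩
          8 * r * length (flat D) ≡⟨ cong (8 * r *_) (length-flat D) ⟩
          8 * r * (r * length D) ≡⟨ lem₄ r (length D) ⟩
          8 * (r * r) * length D ≤⟨ *-monoʳ-≤ (8 * (r * r)) (<⇒≤ D<h) ⟩
          8 * (r * r) * h ≤⟨ d-large ⟩
          d * N ∎)
          where
          lem₃ : ∀ d r f → d * (8 * (r * f)) ≡ 8 * r * (d * f)
          lem₃ = solve-∀
          lem₄ : ∀ r x → 8 * r * (r * x) ≡ 8 * (r * r) * x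
          lem₄ = solve-∀
        b₄ : 8 * (r * length full) * N ^ r ≤ N * N ^ r
        b₄ = *-monoˡ-≤ (N ^ r) full-bound

      progress : ∀ D → Inv D → length D < h →
        2 * length (filter (λ b → length (step D b) ≤? length D) boxes) + length boxes ≤ 2 * length boxes
      progress D I D<h = ≤-trans (+-monoˡ-≤ (length boxes) bound) (≤-reflexive (cong (length boxes +_) (sym (+-identityʳ _))))
        where
        stuck : ∀ {b} → b ∈ filter (λ b → length (step D b) ≤? length D) boxes → b ∈ inadmissible D
        stuck {b} b∈ with admissible? D b | proj₂ (∈-filter⁻ (λ b → length (step D b) ≤? length D) {xs = boxes} b∈)
        ... | no ¬a | _ = ∈-inadmissible D b ¬a
        ... | yes _ | le = ⊥-elim (1+n≰n le)
        bound : 2 * length (filter (λ b → length (step D b) ≤? length D) boxes) ≤ length boxes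
        bound = ≤-trans (*-monoʳ-≤ 2 (unique-⊆-length (UP.filter⁺ _ (words-unique N r)) stuck))
          (≤-trans (length-inadmissible D D<h) (≤-reflexive (sym (length-words N r))))

      length-losing₁ : ∀ k m → 4 * (h + k) ≤ m → 2 ^ k * length (G.losing h m []) ≤ (N ^ r) ^ m
      length-losing₁ k m le = subst (λ z → 2 ^ k * length (G.losing h m []) ≤ z ^ m) (length-words N r)
        -- Success probability at least 1/2, that is q = 2 and b = 3.
        (G.length-losing h step-mono Inv inv-step 2 3 refl progress k m [] (inv [] [] (λ _ → z≤n)) le (s≤s z≤n))

  module Match (D : List Box) where

    Fits : List Box → Box → Set
    Fits M b = b ∈ D × ¬ Touches (flat M) b

    fits? : ∀ M b → Dec (Fits M b)
    fits? M b = (b ∈ᵇ? D) ×-dec ¬? (touches? (flat M) b)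

    step : List Box → Box → List Box
    step M b with fits? M b
    ... | yes _ = b ∷ M
    ... | no _ = M

    record Inv (M : List Box) : Set where
      constructor inv
      field
        members : All (_∈ D) M
        disjoint : AllPairs Disjoint M

    step-mono : ∀ M b → length M ≤ length (step M b)
    step-mono M b with fits? M b
    ... | yes _ = n≤1+n _
    ... | no _ = ≤-refl

    inv-step : ∀ M b → Inv M → Inv (step M b)
    inv-step M b I with fits? M b
    ... | no _ = I
    ... | yes (b∈ , ¬t) = inv (b∈ ∷ Inv.members I) (All.tabulate disj ∷ Inv.disjoint I)
      where
      disj : ∀ {c} → c ∈ M → Disjoint b c
      disj {c} c∈ s s′ e = ¬t (Any.map (λ { refl → subst (_∈ V.toList b) e (lookup∈toList b s) })
        (∈-concatMap V.toList c∈ (lookup∈toList c s′)))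

    module G = Game boxes step length

    run-members : ∀ {m} T M (v : Vec Box m) {b} → b ∈ G.run T M v → b ∈ M ⊎ (∃ λ i → V.lookup v i ≡ b)
    run-members T M [] b∈ = inj₁ b∈
    run-members T M (c ∷ v) b∈ with run-members T (step M c) v b∈
    ... | inj₂ (i , e) = inj₂ (suc i , e)
    ... | inj₁ p with fits? M c
    ...   | no _ = inj₁ p
    run-members T M (c ∷ v) b∈ | inj₁ (here e) | yes _ = inj₂ (zero , sym e)
    run-members T M (c ∷ v) b∈ | inj₁ (there p) | yes _ = inj₁ p

    run-inv : ∀ {m} T M (v : Vec Box m) → Inv M → Inv (G.run T M v)
    run-inv T M [] I = I
    run-inv T M (c ∷ v) I = run-inv T (step M c) v (inv-step M c I)

    module _ (d h T q : ℕ) (ID : Collect.Inv d D) (h≤D : h ≤ length D)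
             (T-small : 2 * (d * (r * T)) ≤ h) (q-large : 2 * N ^ r ≤ q * h) where

      -- The matched boxes use at most r T intervals and each of these blocks at most `d` boxes of
      -- `D`, so by `T-small` at least h / 2 boxes stay available. A draw hits one of them with
      -- probability at least h / (2 Nʳ) ≥ 1 / q.
      progress : ∀ M → Inv M → length M < T →
        q * length (filter (λ b → length (step M b) ≤? length M) boxes) + length boxes ≤ q * length boxes
      progress M I M<T = begin
        q * length bad + length boxes ≤⟨ +-monoʳ-≤ (q * length bad) many ⟩
        q * length bad + q * length good ≡⟨ sym (*-distribˡ-+ q (length bad) (length good)) ⟩
        q * (length bad + length good) ≡⟨ cong (q *_) (length-filter-split (λ b → length (step M b) ≤? length M) boxes) ⟩
        q * length boxes ∎
        where
        open ≤-Reasoning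
        bad = filter (λ b → length (step M b) ≤? length M) boxes
        good = filter (λ b → ¬? (length (step M b) ≤? length M)) boxes
        avail = filter (λ b → ¬? (touches? (flat M) b)) D
        hit = filter (touches? (flat M)) D
        into : ∀ {b} → b ∈ avail → b ∈ good
        into {b} b∈ = ∈-filter⁺ (λ b → ¬? (length (step M b) ≤? length M)) (∈-words b) grows
          where
          grows : ¬ (length (step M b) ≤ length M)
          grows le with fits? M b
          ... | yes _ = 1+n≰n le
          ... | no ¬f = ¬f (∈-filter⁻ (λ b → ¬? (touches? (flat M) b)) b∈)
        hit-bound : 2 * length hit ≤ h
        hit-bound = begin
          2 * length hit ≤⟨ *-monoʳ-≤ 2 (length-touches d (flat M) D (Collect.Inv.degree ID)) ⟩
          2 * (length (flat M) * d) ≡⟨ cong (λ z → 2 * (z * d)) (length-flat M) ⟩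
          2 * (r * length M * d) ≤⟨ *-monoʳ-≤ 2 (*-monoˡ-≤ d (*-monoʳ-≤ r (<⇒≤ M<T))) ⟩
          2 * (r * T * d) ≡⟨ cong (2 *_) (*-comm (r * T) d) ⟩
          2 * (d * (r * T)) ≤⟨ T-small ⟩
          h ∎
        avail-bound : h ≤ 2 * length avail
        avail-bound = +-cancelˡ-≤ h h _ (begin
          h + h ≤⟨ +-mono-≤ h≤D h≤D ⟩
          length D + length D ≡⟨ cong (λ z → z + z) (sym (length-filter-split (touches? (flat M)) D)) ⟩
          (length hit + length avail) + (length hit + length avail) ≡⟨ lem (length hit) (length avail) ⟩
          2 * length hit + 2 * length avail ≤⟨ +-monoˡ-≤ _ hit-bound ⟩
          h + 2 * length avail ∎)
          where
          lem : ∀ x y → (x + y) + (x + y) ≡ 2 * x + 2 * y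
          lem = solve-∀
        many : length boxes ≤ q * length good
        many = *-cancelˡ-≤ 2 (begin
          2 * length boxes ≡⟨ cong (2 *_) (length-words N r) ⟩
          2 * N ^ r ≤⟨ q-large ⟩
          q * h ≤⟨ *-monoʳ-≤ q avail-bound ⟩
          q * (2 * length avail) ≤⟨ *-monoʳ-≤ q (*-monoʳ-≤ 2 (unique-⊆-length (UP.filter⁺ _ (Collect.Inv.distinct ID)) into)) ⟩
          q * (2 * length good) ≡⟨ lem q (length good) ⟩
          2 * (q * length good) ∎)
          where
          lem : ∀ q x → q * (2 * x) ≡ 2 * (q * x)
          lem = solve-∀

      length-losing₂ : ∀ k m → 2 * q * (T + k) ≤ m → 1 ≤ q → 2 ^ k * length (G.losing T m []) ≤ (N ^ r) ^ m
      length-losing₂ k m le 1≤q = subst (λ z → 2 ^ k * length (G.losing T m []) ≤ z ^ m) (length-words N r)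
        (G.length-losing T step-mono Inv inv-step q (pred (2 * q)) (sym (suc-pred (2 * q))) progress k m [] (inv [] []) le 1≤q)
        where
        instance
          q≢0 : NonZero q
          q≢0 = >-nonZero 1≤q
          2q≢0 : NonZero (2 * q)
          2q≢0 = m*n≢0 2 q

  -- `disjoint` settles the order of labels from different boxes and `injective` that of labels from
  -- one box; by `twice` each box supplies one edge to each twin.
  record Pairing {n} (β : Vec Box n) (T : ℕ) : Set where
    constructor pairing
    field
      used : List Box
      enough : T ≤ length used
      injective : All VU.Unique used
      disjoint : AllPairs Disjoint used
      twice : All (λ b → ∃ λ e → ∃ λ f → V.lookup β e ≡ b × V.lookup β f ≡ b × e ≢ f) used

  module _ (d h T q k m₁ m₂ : ℕ)
           (1≤d : 1 ≤ d) (1≤N : 1 ≤ N) (N-large : 8 * (r * r) ≤ N) (d-large : 8 * (r * r) * h ≤ d * N) (h-small : 4 * h ≤ N ^ r)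
           (T-small : 2 * (d * (r * T)) ≤ h) (q-large : 2 * N ^ r ≤ q * h) (1≤q : 1 ≤ q)
           (m₁-large : 4 * (h + k) ≤ m₁) (m₂-large : 2 * q * (T + k) ≤ m₂) where

    private
      module C = Collect d
      module M = Match

      collected : Vec Box m₁ → List Box
      collected = C.G.run h []

      enough? : (v : Vec Box m₁) → Dec (h ≤ length (collected v))
      enough? v = h ≤? length (collected v)

      -- `bad₁` leaves the second batch free. `bad₂` conditions on a first batch that collected
      -- enough, because `length-losing₂` relies on at least `h` boxes in `D`.
      bad₁ bad₂ : List (Vec Box (m₁ + m₂))
      bad₁ = cartesianProductWith V._++_ (C.G.losing h m₁ []) (vecs boxes m₂)
      bad₂ = concatMap (λ v → L.map (v V.++_) (M.G.losing (collected v) T m₂ [])) (filter enough? (vecs boxes m₁))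

    unpaired : List (Vec Box (m₁ + m₂))
    unpaired = bad₁ ++ bad₂

    length-unpaired : 2 ^ k * length unpaired ≤ 2 * (N ^ r) ^ (m₁ + m₂)
    length-unpaired = begin
      2 ^ k * length (bad₁ ++ bad₂) ≡⟨ cong (2 ^ k *_) (LP.length-++ bad₁) ⟩
      2 ^ k * (length bad₁ + length bad₂) ≡⟨ *-distribˡ-+ (2 ^ k) (length bad₁) _ ⟩
      2 ^ k * length bad₁ + 2 ^ k * length bad₂ ≤⟨ +-mono-≤ b₁ b₂ ⟩
      a ^ (m₁ + m₂) + a ^ (m₁ + m₂) ≡⟨ cong (a ^ (m₁ + m₂) +_) (sym (+-identityʳ _)) ⟩
      2 * a ^ (m₁ + m₂) ∎
      where
      open ≤-Reasoning
      a = N ^ r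
      len : ∀ m → length (vecs boxes m) ≡ a ^ m
      len m = trans (length-vecs boxes m) (cong (_^ m) (length-words N r))
      b₁ : 2 ^ k * length bad₁ ≤ a ^ (m₁ + m₂)
      b₁ = begin
        2 ^ k * length bad₁ ≡⟨ cong (2 ^ k *_)
          (trans (length-cartesianProductWith V._++_ (C.G.losing h m₁ []) (vecs boxes m₂))
          (cong (length (C.G.losing h m₁ []) *_) (len m₂))) ⟩
        2 ^ k * (length (C.G.losing h m₁ []) * a ^ m₂) ≡⟨ sym (*-assoc (2 ^ k) _ _) ⟩
        2 ^ k * length (C.G.losing h m₁ []) * a ^ m₂
          ≤⟨ *-monoˡ-≤ (a ^ m₂) (C.length-losing₁ h 1≤d 1≤N N-large d-large h-small k m₁ m₁-large) ⟩
        a ^ m₁ * a ^ m₂ ≡⟨ sym (^-distribˡ-+-* a m₁ m₂) ⟩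
        a ^ (m₁ + m₂) ∎
      second : ∀ {v} → v ∈ filter enough? (vecs boxes m₁) →
        2 ^ k * length (L.map (v V.++_) (M.G.losing (collected v) T m₂ [])) ≤ a ^ m₂
      second {v} v∈ rewrite LP.length-map (v V.++_) (M.G.losing (collected v) T m₂ []) =
        M.length-losing₂ (collected v) d h T q (C.run-inv h [] v (C.inv [] [] (λ _ → z≤n)))
          (proj₂ (∈-filter⁻ enough? {xs = vecs boxes m₁} v∈)) T-small q-large k m₂ m₂-large 1≤q
      b₂ : 2 ^ k * length bad₂ ≤ a ^ (m₁ + m₂)
      b₂ = begin
        2 ^ k * length bad₂ ≤⟨ length-concatMap-≤ _ (filter enough? (vecs boxes m₁)) (a ^ m₂) (2 ^ k) second ⟩
        length (filter enough? (vecs boxes m₁)) * a ^ m₂ ≤⟨ *-monoˡ-≤ (a ^ m₂)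
          (≤-trans (LP.length-filter enough? (vecs boxes m₁)) (≤-reflexive (len m₁))) ⟩
        a ^ m₁ * a ^ m₂ ≡⟨ sym (^-distribˡ-+-* a m₁ m₂) ⟩
        a ^ (m₁ + m₂) ∎

    -- A matched box was collected from the first m₁ edges and drawn again among the last m₂, so its
    -- two edges lie in different batches and are distinct.
    unpaired-or-pairing : ∀ β → β ∈ unpaired ⊎ Pairing β T
    unpaired-or-pairing β with V.splitAt m₁ β
    ... | v , w , refl with enough? v
    ...   | no ¬e = inj₁ (∈-++⁺ˡ (∈-cartesianProductWith⁺ V._++_ (C.G.∈-losing h [] v (λ _ → ∈-words _) (≰⇒> ¬e))
      (∈-vecs w (λ _ → ∈-words _))))
    ...   | yes e with T ≤? length (M.G.run (collected v) T [] w)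
    ...     | no ¬T = inj₁ (∈-++⁺ʳ bad₁ (∈-concatMap (λ v → L.map (v V.++_) (M.G.losing (collected v) T m₂ []))
                (∈-filter⁺ enough? (∈-vecs v (λ _ → ∈-words _)) e)
                (∈-map⁺ (v V.++_) (M.G.∈-losing (collected v) T [] w (λ _ → ∈-words _) (≰⇒> ¬T)))))
    ...     | yes T≤ = inj₂ (pairing X T≤ (All.map (λ b∈ → All.lookup (C.Inv.injective IC) b∈) (M.Inv.members IM))
      (M.Inv.disjoint IM) (All.tabulate both))
      where
      X = M.G.run (collected v) T [] w
      IC = C.run-inv h [] v (C.inv [] [] (λ _ → z≤n))
      IM = M.run-inv (collected v) T [] w (M.inv [] [])
      both : ∀ {b} → b ∈ X → ∃ λ e → ∃ λ f → V.lookup (v V.++ w) e ≡ b × V.lookup (v V.++ w) f ≡ b × e ≢ f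
      both b∈ with C.run-members h [] v (All.lookup (M.Inv.members IM) b∈) | M.run-members (collected v) T [] w b∈
      ... | inj₂ (i , ei) | inj₂ (j , ej) = i F.↑ˡ m₂ , m₁ F.↑ʳ j ,
        trans (VP.lookup-++ˡ v w i) ei , trans (VP.lookup-++ʳ v w j) ej ,
        λ eq → case trans (sym (FP.splitAt-↑ˡ m₁ i m₂)) (trans (cong (F.splitAt m₁) eq) (FP.splitAt-↑ʳ m₁ m₂ j)) of λ ()

-- Increasing lists, sorting and first occurrences

toVec : {A : Set} {m : ℕ} (xs : List A) → .(length xs ≡ m) → Vec A m
toVec xs eq = V.cast eq (V.fromList xs)

toList-toVec : {A : Set} {m : ℕ} (xs : List A) .(eq : length xs ≡ m) → V.toList (toVec xs eq) ≡ xs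
toList-toVec xs eq = trans (VP.toList-cast eq (V.fromList xs)) (VP.toList∘fromList xs)

toList-inj : {A : Set} {m : ℕ} (v w : Vec A m) → V.toList v ≡ V.toList w → v ≡ w
toList-inj [] [] _ = refl
toList-inj (x ∷ v) (y ∷ w) e = cong₂ _∷_ (LP.∷-injectiveˡ e) (toList-inj v w (LP.∷-injectiveʳ e))

vec-ext : {A : Set} {m : ℕ} (v w : Vec A m) → (∀ i → V.lookup v i ≡ V.lookup w i) → v ≡ w
vec-ext v w h = trans (sym (VP.tabulate∘lookup v)) (trans (VP.tabulate-cong h) (VP.tabulate∘lookup w))

AllPairs-lookup : {A : Set} {R : A → A → Set} {m : ℕ} (v : Vec A m) → AllPairs R (V.toList v) →
  ∀ {i j} → toℕ i < toℕ j → R (V.lookup v i) (V.lookup v j)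
AllPairs-lookup (x ∷ v) (h ∷ _) {zero} {suc j} _ = All.lookup h (lookup∈toList v j)
AllPairs-lookup (x ∷ v) (_ ∷ hs) {suc i} {suc j} (s≤s lt) = AllPairs-lookup v hs lt

-- Compare the heads: they agree, or the head of `xs` is smaller and can be skipped. With `∈-combos`
-- this places every increasing vector among the binomially many choices.
increasing-⊆ : ∀ {K} {xs ys : List (Fin K)} → AllPairs F._<_ xs → AllPairs F._<_ ys →
  (∀ {y} → y ∈ ys → y ∈ xs) → ys ⊆ xs
increasing-⊆ {xs = xs} {[]} _ _ _ = SLP.[]⊆-universal xs
increasing-⊆ {xs = []} {y ∷ ys} _ _ sub with sub (here refl)
... | ()
increasing-⊆ {xs = x ∷ xs} {y ∷ ys} (hx ∷ ax) (hy ∷ ay) sub with sub (here refl)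
... | here refl = refl ∷ increasing-⊆ ax ay sub′
  where
  sub′ : ∀ {z} → z ∈ ys → z ∈ xs
  sub′ z∈ with sub (there z∈)
  ... | here refl = ⊥-elim (<-irrefl refl (All.lookup hy z∈))
  ... | there p = p
... | there y∈ = x ∷ʳ increasing-⊆ ax (hy ∷ ay) sub′
  where
  sub′ : ∀ {z} → z ∈ y ∷ ys → z ∈ xs
  sub′ (here refl) = y∈
  sub′ (there z∈) with sub (there z∈)
  ... | here refl = ⊥-elim (<-asym (All.lookup hy z∈) (All.lookup hx y∈))
  ... | there p = p

increasing-combos : ∀ {K m} (v : Vec (Fin K) m) → AllPairs F._<_ (V.toList v) → v ∈ combos (L.allFin K) m
increasing-combos {K} v inc = ∈-combos v (increasing-⊆ (APP.tabulate⁺-< (λ lt → lt)) inc (λ _ → ∈-allFin _))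

module SortBy {X : Set} {K : ℕ} (key : X → Fin K) where

  open Data.List.Sort (On.decTotalOrder (FP.≤-decTotalOrder K) key) public using (sort; sort-↭; sort-↗)

  sort-unique : ∀ {xs} → Unique xs → Unique (sort xs)
  sort-unique {xs} u = PSP.Unique-resp-↭ (setoid X) (↭⇒↭ₛ (↭-sym (sort-↭ xs))) u

  sort-increasing : (∀ {x y} → key x ≡ key y → x ≡ y) → ∀ {xs} → Unique xs →
    AllPairs F._<_ (L.map key (sort xs))
  sort-increasing inj {xs} u = APP.map⁺ (AP.zipWith (λ (le , ne) → ≤∧≢⇒< le (ne ∘ inj ∘ FP.toℕ-injective))
    (Linked⇒AllPairs ≤-trans (sort-↗ xs) , sort-unique u))

-- The ordering clause of `IsMatching`, for edges y and z with consecutive letters.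
Before : {A : Set} {m : ℕ} → Vec A m → A → A → Set
Before v y z = ∀ i → V.lookup v i ≡ z → ∃ λ j → toℕ j < toℕ i × V.lookup v j ≡ y

-- `deduplicate` keeps first occurrences in their order, so numbering the edges along its result
-- yields the canonical letters.
deduplicate-ordered : ∀ {n m} (v : Vec (Fin n) m) → AllPairs (Before v) (deduplicate FP._≟_ (V.toList v))
deduplicate-ordered [] = []
deduplicate-ordered {n} (x ∷ v) =
  All.map first (AllP.all-filter (¬? ∘ (x FP.≟_)) (deduplicate FP._≟_ (V.toList v)))
  ∷ AP.map later (AP.zip (APP.filter⁺ (¬? ∘ (x FP.≟_)) (deduplicate-ordered v) , all-neq))
  where
  first : ∀ {z} → x ≢ z → Before (x ∷ v) x z
  first x≢z zero e = ⊥-elim (x≢z e)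
  first x≢z (suc i) e = zero , s≤s z≤n , refl
  constʳ : ∀ {zs : List (Fin n)} → All (x ≢_) zs → AllPairs (λ _ z → x ≢ z) zs
  constʳ [] = []
  constʳ (_ ∷ h) = h ∷ constʳ h
  all-neq = constʳ (AllP.all-filter (¬? ∘ (x FP.≟_)) (deduplicate FP._≟_ (V.toList v)))
  later : ∀ {y z} → Before v y z × x ≢ z → Before (x ∷ v) y z
  later (b , x≢z) zero e = ⊥-elim (x≢z e)
  later (b , x≢z) (suc i) e with b i e
  ... | j , lt , e′ = suc j , s≤s lt , e′

count-toList : ∀ {n m} (a : Fin n) (v : Vec (Fin n) m) → V.count (FP._≟ a) v ≡ length (filter (FP._≟ a) (V.toList v))
count-toList a [] = refl
count-toList a (x ∷ v) with x FP.≟ a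
... | yes _ = cong suc (count-toList a v)
... | no _ = count-toList a v

length-filter-map : {A B : Set} {P : B → Set} {Q : A → Set} (P? : Decidable P) (Q? : Decidable Q) (f : A → B) →
  (∀ x → P (f x) → Q x) → (∀ x → Q x → P (f x)) → ∀ xs → length (filter P? (L.map f xs)) ≡ length (filter Q? xs)
length-filter-map P? Q? f to from [] = refl
length-filter-map P? Q? f to from (x ∷ xs) with P? (f x) | Q? x
... | yes _ | yes _ = cong suc (length-filter-map P? Q? f to from xs)
... | no _ | no _ = length-filter-map P? Q? f to from xs
... | yes p | no ¬q = ⊥-elim (¬q (to x p))
... | no ¬p | yes q = ⊥-elim (¬p (from x q))

module Columns {A B : Set} (_≟_ : DecidableEquality A) where

  column : A → List (A × B) → List B
  column j = L.map proj₂ ∘ filter (λ p → j ≟ proj₁ p)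

  column-absent : ∀ {j xs} (ys : List B) → j ∉ xs → column j (cartesianProduct xs ys) ≡ []
  column-absent {j} {xs} ys j∉ = cong (L.map proj₂) (LP.filter-none (λ p → j ≟ proj₁ p)
    (All.tabulate (λ {p} p∈ e → j∉ (subst (_∈ xs) (sym e) (proj₁ (∈-cartesianProduct⁻ xs ys p∈))))))

  column-cartesianProduct : ∀ {j xs} (ys : List B) → Unique xs → j ∈ xs → column j (cartesianProduct xs ys) ≡ ys
  column-cartesianProduct {j} {x ∷ xs} ys (x∉ ∷ u) j∈ =
    trans (cong (L.map proj₂) (LP.filter-++ (λ p → j ≟ proj₁ p) (L.map (x ,_) ys) (cartesianProduct xs ys)))
      (trans (LP.map-++ proj₂ (filter (λ p → j ≟ proj₁ p) (L.map (x ,_) ys)) _) (split j∈))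
    where
    mapproj : ∀ ys → L.map proj₂ (L.map (x ,_) ys) ≡ ys
    mapproj [] = refl
    mapproj (y ∷ ys) = cong (y ∷_) (mapproj ys)
    split : j ∈ x ∷ xs → column j (L.map (x ,_) ys) ++ column j (cartesianProduct xs ys) ≡ ys
    split (here refl) = trans (cong₂ _++_
      (trans (cong (L.map proj₂) (LP.filter-all (λ p → x ≟ proj₁ p) (AllP.map⁺ (All.universal (λ _ → refl) ys)))) (mapproj ys))
      (column-absent ys (λ x∈ → All.lookup x∉ x∈ refl))) (LP.++-identityʳ ys)
    split (there j∈′) = cong₂ _++_
      (cong (L.map proj₂) (LP.filter-none (λ p → j ≟ proj₁ p) (AllP.map⁺ (All.universal (λ _ e → All.lookup x∉ j∈′ (sym e)) ys))))
      (column-cartesianProduct ys u j∈′)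

  -- A list of pairs is a shuffle of its columns, and the first coordinates tell which column
  -- supplies the next entry.
  columns-determine : (ps qs : List (A × B)) → L.map proj₁ ps ≡ L.map proj₁ qs →
    (∀ j → column j ps ≡ column j qs) → ps ≡ qs
  columns-determine [] [] _ _ = refl
  columns-determine [] (_ ∷ _) () _
  columns-determine (_ ∷ _) [] () _
  columns-determine ((j , s) ∷ ps) ((j′ , s′) ∷ qs) e h with LP.∷-injectiveˡ e
  ... | refl = cong₂ _∷_ (cong (j ,_) (LP.∷-injectiveˡ head)) (columns-determine ps qs (LP.∷-injectiveʳ e) tail)
    where
    head : s ∷ column j ps ≡ s′ ∷ column j qs
    head = trans (sym (cong (L.map proj₂) (LP.filter-accept (λ p → j ≟ proj₁ p) {j , s} {ps} refl)))
             (trans (h j) (cong (L.map proj₂) (LP.filter-accept (λ p → j ≟ proj₁ p) {j , s′} {qs} refl)))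
    tail : ∀ i → column i ps ≡ column i qs
    tail i with i ≟ j | h i
    ... | yes _ | hi = LP.∷-injectiveʳ hi
    ... | no _ | hi = hi

-- From independent labels to canonical matching words

module Outcomes (K n r : ℕ) (1≤r : 1 ≤ r) where

  open Columns {Fin n} {Fin r} FP._≟_

  Outcome Slot : Set
  Outcome = Vec (Vec (Fin K) r) n
  Slot = Fin n × Fin r

  lab : Outcome → Slot → Fin K
  lab ω (j , s) = V.lookup (V.lookup ω j) s

  slots : List Slot
  slots = cartesianProduct (L.allFin n) (L.allFin r)

  ∈-slots : ∀ p → p ∈ slots
  ∈-slots (j , s) = ∈-cartesianProduct⁺ (∈-allFin j) (∈-allFin s)

  slots-unique : Unique slots
  slots-unique = UP.cartesianProduct⁺ (UP.allFin⁺ n) (UP.allFin⁺ r)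

  length-slots : length slots ≡ r * n
  length-slots = trans (length-cartesianProductWith _,_ (L.allFin n) (L.allFin r))
    (trans (cong₂ _*_ (length-allFin n) (length-allFin r)) (*-comm n r))

  TieFree : Outcome → Set
  TieFree ω = ∀ {p q} → lab ω p ≡ lab ω q → p ≡ q

  unique⇒tieFree : ∀ ω → VU.Unique (V.concat ω) → TieFree ω
  unique⇒tieFree ω u {j , s} {j′ , s′} e with FP.combine-injective j s j′ s′
    (VUP.lookup-injective u (F.combine j s) (F.combine j′ s′)
      (trans (VP.lookup-concat ω j s) (trans e (sym (VP.lookup-concat ω j′ s′)))))
  ... | refl , refl = refl

  abstract
    sorted : Outcome → List Slot
    sorted ω = SortBy.sort (lab ω) slots

    sorted-↭ : ∀ ω → sorted ω ↭ slots
    sorted-↭ ω = SortBy.sort-↭ (lab ω) slots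

    sorted-increasing : ∀ ω → TieFree ω → AllPairs F._<_ (L.map (lab ω) (sorted ω))
    sorted-increasing ω tf = SortBy.sort-increasing (lab ω) tf slots-unique

  abstract
    slotAt : Outcome → Vec Slot (r * n)
    slotAt ω = toVec (sorted ω) (trans (PP.↭-length (sorted-↭ ω)) length-slots)

    toList-slotAt : ∀ ω → V.toList (slotAt ω) ≡ sorted ω
    toList-slotAt ω = toList-toVec (sorted ω) _

    position : ∀ ω p → ∃ λ i → V.lookup (slotAt ω) i ≡ p
    position ω p = ∈toList⇒lookup (slotAt ω)
      (subst (p ∈_) (sym (toList-slotAt ω)) (PP.∈-resp-↭ (↭-sym (sorted-↭ ω)) (∈-slots p)))

  owners : Outcome → Vec (Fin n) (r * n)
  owners ω = V.map proj₁ (slotAt ω)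

  abstract
    appearance : Outcome → List (Fin n)
    appearance ω = deduplicate FP._≟_ (V.toList (owners ω))

    appearance-unique : ∀ ω → Unique (appearance ω)
    appearance-unique ω = UDP.deduplicate-! FP._≟_ (V.toList (owners ω))

    ∈-appearance : ∀ ω j → j ∈ appearance ω
    ∈-appearance ω j = ∈-deduplicate⁺ FP._≟_ (subst (_∈ V.toList (owners ω)) e (lookup∈toList (owners ω) i))
      where
      i : Fin (r * n)
      i = proj₁ (position ω (j , F.fromℕ< 1≤r))
      e : V.lookup (owners ω) i ≡ j
      e = trans (VP.lookup-map i proj₁ (slotAt ω)) (cong proj₁ (proj₂ (position ω (j , F.fromℕ< 1≤r))))

    length-appearance : ∀ ω → length (appearance ω) ≡ n
    length-appearance ω = ≤-antisym
      (≤-trans (unique-⊆-length (appearance-unique ω) (λ _ → ∈-allFin _)) (≤-reflexive (length-allFin n)))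
      (≤-trans (≤-reflexive (sym (length-allFin n))) (unique-⊆-length (UP.allFin⁺ n) (λ _ → ∈-appearance ω _)))

    appearance-ordered : ∀ ω → AllPairs (Before (owners ω)) (appearance ω)
    appearance-ordered ω = deduplicate-ordered (owners ω)

  abstract
    edges : Outcome → Vec (Fin n) n
    edges ω = toVec (appearance ω) (length-appearance ω)

    toList-edges : ∀ ω → V.toList (edges ω) ≡ appearance ω
    toList-edges ω = toList-toVec (appearance ω) _

  edge : Outcome → Fin n → Fin n
  edge ω = V.lookup (edges ω)

  abstract
    letter-exists : ∀ ω j → ∃ λ a → edge ω a ≡ j
    letter-exists ω j = ∈toList⇒lookup (edges ω) (subst (j ∈_) (sym (toList-edges ω)) (∈-appearance ω j))

  -- Edges are renamed by first appearance in the sorted order; this makes `word` the canonical word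
  -- of its matching.
  letter : Outcome → Fin n → Fin n
  letter ω j = proj₁ (letter-exists ω j)

  edge-letter : ∀ ω j → edge ω (letter ω j) ≡ j
  edge-letter ω j = proj₂ (letter-exists ω j)

  edge-injective : ∀ ω {a b} → edge ω a ≡ edge ω b → a ≡ b
  edge-injective ω {a} {b} e with FP.<-cmp a b
  ... | tri≈ _ eq _ = eq
  ... | tri< lt _ _ = ⊥-elim (AllPairs-lookup (edges ω) (subst Unique (sym (toList-edges ω)) (appearance-unique ω)) lt e)
  ... | tri> _ _ gt = ⊥-elim (AllPairs-lookup (edges ω) (subst Unique (sym (toList-edges ω)) (appearance-unique ω)) gt (sym e))

  letter-edge : ∀ ω a → letter ω (edge ω a) ≡ a
  letter-edge ω a = edge-injective ω (edge-letter ω (edge ω a))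

  word : Outcome → Word (r * n) n
  word ω = V.map (letter ω) (owners ω)

  lookup-word : ∀ ω i → V.lookup (word ω) i ≡ letter ω (proj₁ (V.lookup (slotAt ω) i))
  lookup-word ω i = trans (VP.lookup-map i (letter ω) (owners ω)) (cong (letter ω) (VP.lookup-map i proj₁ (slotAt ω)))

  column-sorted : ∀ ω j → column j (sorted ω) ↭ L.allFin r
  column-sorted ω j = subst (column j (sorted ω) ↭_) (column-cartesianProduct (L.allFin r) (UP.allFin⁺ n) (∈-allFin j))
    (PP.map⁺ proj₂ (PP.filter-↭ (λ p → j FP.≟ proj₁ p) (sorted-↭ ω)))

  word-count : ∀ ω a → V.count (FP._≟ a) (word ω) ≡ r
  word-count ω a = begin
    V.count (FP._≟ a) (word ω) ≡⟨ count-toList a (word ω) ⟩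
    length (filter (FP._≟ a) (V.toList (word ω))) ≡⟨ cong (λ z → length (filter (FP._≟ a) z)) toList-word ⟩
    length (filter (FP._≟ a) (L.map (letter ω ∘ proj₁) (sorted ω)))
      ≡⟨ length-filter-map (FP._≟ a) (λ p → edge ω a FP.≟ proj₁ p) (letter ω ∘ proj₁)
           (λ p e → trans (cong (edge ω) (sym e)) (edge-letter ω (proj₁ p)))
             (λ p e → trans (cong (letter ω) (sym e)) (letter-edge ω a)) (sorted ω) ⟩
    length (filter (λ p → edge ω a FP.≟ proj₁ p) (sorted ω)) ≡⟨ sym
      (LP.length-map proj₂ (filter (λ p → edge ω a FP.≟ proj₁ p) (sorted ω))) ⟩
    length (column (edge ω a) (sorted ω)) ≡⟨ PP.↭-length (column-sorted ω (edge ω a)) ⟩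
    length (L.allFin r) ≡⟨ length-allFin r ⟩
    r ∎
    where
    open ≡-Reasoning
    toList-word : V.toList (word ω) ≡ L.map (letter ω ∘ proj₁) (sorted ω)
    toList-word = trans (VP.toList-map (letter ω) (owners ω))
      (trans (cong (L.map (letter ω)) (trans (VP.toList-map proj₁ (slotAt ω)) (cong (L.map proj₁) (toList-slotAt ω))))
      (sym (LP.map-∘ (sorted ω))))

  edges-ordered : ∀ ω {a b} → toℕ a < toℕ b → Before (owners ω) (edge ω a) (edge ω b)
  edges-ordered ω = AllPairs-lookup (edges ω) (subst (AllPairs (Before (owners ω))) (sym (toList-edges ω)) (appearance-ordered ω))

  edge-word : ∀ ω i → edge ω (V.lookup (word ω) i) ≡ V.lookup (owners ω) i
  edge-word ω i = trans (cong (edge ω) (VP.lookup-map i (letter ω) (owners ω))) (edge-letter ω (V.lookup (owners ω) i))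

  word-ordered : ∀ ω i a → toℕ (V.lookup (word ω) i) ≡ suc a →
    ∃ λ j → (toℕ j < toℕ i) × (toℕ (V.lookup (word ω) j) ≡ a)
  word-ordered ω i a e =
    let j , lt , e′ = edges-ordered ω a′<b i (sym (edge-word ω i)) in
    j , lt , trans (cong toℕ (edge-injective ω (trans (edge-word ω j) e′))) (FP.toℕ-fromℕ< a<n)
    where
    a<n : a < n
    a<n = <-trans (subst (a <_) (sym e) ≤-refl) (FP.toℕ<n (V.lookup (word ω) i))
    a′<b : toℕ (F.fromℕ< a<n) < toℕ (V.lookup (word ω) i)
    a′<b = subst₂ _<_ (sym (FP.toℕ-fromℕ< a<n)) (sym e) ≤-refl

  word-matching : ∀ ω → IsMatching r n (word ω)
  word-matching ω = word-count ω , word-ordered ω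

  labels : Outcome → Vec (Fin K) (r * n)
  labels ω = V.map (lab ω) (slotAt ω)

  labels-increasing : ∀ ω → TieFree ω → AllPairs F._<_ (V.toList (labels ω))
  labels-increasing ω tf = subst (AllPairs F._<_)
    (sym (trans (VP.toList-map (lab ω) (slotAt ω)) (cong (L.map (lab ω)) (toList-slotAt ω))))
    (sorted-increasing ω tf)

  -- What must accompany the word to recover a tie-free outcome: the increasing list of labels, the
  -- original names of the edges in order of appearance (n! choices), and for each edge the order of
  -- its slots (r! choices).
  Code : Set
  Code = Word (r * n) n × Vec (Fin K) (r * n) × List (Fin n) × Vec (List (Fin r)) n

  code : Outcome → Code
  code ω = word ω , labels ω , appearance ω , V.tabulate (λ j → column j (sorted ω))

  codes : List (Word (r * n) n) → List Code
  codes ws = cartesianProduct ws (cartesianProduct (combos (L.allFin K) (r * n))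
    (cartesianProduct (perms (L.allFin n)) (vecs (perms (L.allFin r)) n)))

  unique-complete-↭ : ∀ {m} (xs : List (Fin m)) → Unique xs → (∀ j → j ∈ xs) → xs ↭ L.allFin m
  unique-complete-↭ {m} xs u all = go xs (L.allFin m) u (UP.allFin⁺ m) (λ _ → ∈-allFin _) (λ _ → all _)
    where
    go : ∀ (xs ys : List (Fin m)) → Unique xs → Unique ys → (∀ {z} → z ∈ xs → z ∈ ys) → (∀ {z} → z ∈ ys → z ∈ xs) → xs ↭ ys
    go [] [] _ _ _ _ = ↭-refl
    go [] (y ∷ ys) _ _ _ h with h (here refl)
    ... | ()
    go (x ∷ xs) ys (x∉ ∷ u) u′ to from with ∈-∃++ (to (here refl))
    ... | as , bs , refl with PSP.Unique-resp-↭ (setoid (Fin m)) (↭⇒↭ₛ (PP.shift x as bs)) u′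
    ...   | x∉′ ∷ u″ = ↭-trans (↭-prep x (go xs (as ++ bs) u u″ to′ from′)) (↭-sym (PP.shift x as bs))
      where
      to′ : ∀ {z} → z ∈ xs → z ∈ as ++ bs
      to′ z∈ with PP.∈-resp-↭ (PP.shift x as bs) (to (there z∈))
      ... | here refl = ⊥-elim (All.lookup x∉ z∈ refl)
      ... | there p = p
      from′ : ∀ {z} → z ∈ as ++ bs → z ∈ xs
      from′ z∈ with from (PP.∈-resp-↭ (↭-sym (PP.shift x as bs)) (there z∈))
      ... | here refl = ⊥-elim (All.lookup x∉′ z∈ refl)
      ... | there p = p

  ∈-codes : ∀ {ws} ω → TieFree ω → word ω ∈ ws → code ω ∈ codes ws
  ∈-codes ω tf w∈ = ∈-cartesianProduct⁺ w∈ (∈-cartesianProduct⁺ (increasing-combos (labels ω) (labels-increasing ω tf))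
    (∈-cartesianProduct⁺ (∈-perms (L.allFin n) (unique-complete-↭ (appearance ω) (appearance-unique ω) (∈-appearance ω)))
      (∈-vecs _ (λ j → subst (_∈ perms (L.allFin r)) (sym (VP.lookup∘tabulate _ j)) (∈-perms (L.allFin r) (column-sorted ω j))))))

  -- The word and `appearance` give the owner of every position, owners and columns give the sorted
  -- slots, and `labels` then supplies the values.
  code-injective : ∀ ω ω′ → code ω ≡ code ω′ → ω ≡ ω′
  code-injective ω ω′ eq = vec-ext ω ω′ (λ j → vec-ext _ _ (λ s → same-lab (j , s)))
    where
    eq-word = cong proj₁ eq
    eq-labels = cong (proj₁ ∘ proj₂) eq
    eq-app : appearance ω ≡ appearance ω′
    eq-app = cong (proj₁ ∘ proj₂ ∘ proj₂) eq
    eq-columns = cong (proj₂ ∘ proj₂ ∘ proj₂) eq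
    eq-edges : edges ω ≡ edges ω′
    eq-edges = toList-inj _ _ (trans (toList-edges ω) (trans eq-app (sym (toList-edges ω′))))
    eq-owners : owners ω ≡ owners ω′
    eq-owners = vec-ext _ _ (λ i → trans (sym (edge-word ω i))
      (trans (cong₂ (λ E w → V.lookup E (V.lookup w i)) eq-edges eq-word) (edge-word ω′ i)))
    owner-list : ∀ ω → L.map proj₁ (sorted ω) ≡ V.toList (owners ω)
    owner-list ω = trans (cong (L.map proj₁) (sym (toList-slotAt ω))) (sym (VP.toList-map proj₁ (slotAt ω)))
    eq-sorted : sorted ω ≡ sorted ω′
    eq-sorted = columns-determine _ _ (trans (owner-list ω) (trans (cong V.toList eq-owners) (sym (owner-list ω′))))
      (λ j → trans (sym (VP.lookup∘tabulate _ j)) (trans (cong (λ v → V.lookup v j) eq-columns) (VP.lookup∘tabulate _ j)))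
    eq-slotAt : slotAt ω ≡ slotAt ω′
    eq-slotAt = toList-inj _ _ (trans (toList-slotAt ω) (trans eq-sorted (sym (toList-slotAt ω′))))
    same-lab : ∀ p → lab ω p ≡ lab ω′ p
    same-lab p with position ω p
    ... | i , refl = trans (sym (VP.lookup-map i (lab ω) (slotAt ω))) (trans (cong (λ v → V.lookup v i) eq-labels)
      (trans (VP.lookup-map i (lab ω′) (slotAt ω′)) (cong (λ v → lab ω′ (V.lookup v i)) (sym eq-slotAt))))

  length-codes : ∀ ws → length (codes ws) ≤ length ws * (length (combos (L.allFin K) (r * n)) * (n ! * (r !) ^ n))
  length-codes ws = begin
    length (codes ws) ≡⟨ length-cartesianProductWith _,_ ws _ ⟩
    length ws * length (cartesianProduct cs (cartesianProduct ps vs)) ≡⟨ cong (length ws *_)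
      (length-cartesianProductWith _,_ cs _) ⟩
    length ws * (length cs * length (cartesianProduct ps vs)) ≡⟨ cong (λ z → length ws * (length cs * z))
      (length-cartesianProductWith _,_ ps vs) ⟩
    length ws * (length cs * (length ps * length vs)) ≤⟨ *-monoʳ-≤ (length ws)
      (*-monoʳ-≤ (length cs) (*-mono-≤ (len n) (≤-trans (≤-reflexive (length-vecs (perms (L.allFin r)) n))
      (^-monoˡ-≤ n (len r))))) ⟩
    length ws * (length cs * (n ! * (r !) ^ n)) ∎
    where
    open ≤-Reasoning
    cs = combos (L.allFin K) (r * n)
    ps = perms (L.allFin n)
    vs = vecs (perms (L.allFin r)) n
    len : ∀ m → length (perms (L.allFin m)) ≤ m !
    len m = subst (λ z → length (perms (L.allFin m)) ≤ z !) (length-allFin m) (length-perms (L.allFin m))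

  -- Every matching word comes from at most C(K, rn) n! (r!)ⁿ tie-free outcomes, and C(K, rn) (rn)! ≤ Kʳⁿ.
  length-words-of : ∀ {ωs ws} → Unique ωs → (∀ {ω} → ω ∈ ωs → TieFree ω × word ω ∈ ws) →
    length ωs * (r * n) ! ≤ K ^ (r * n) * (length ws * ((r !) ^ n * n !))
  length-words-of {ωs} {ws} u h = begin
    length ωs * (r * n) !
      ≤⟨ *-monoˡ-≤ ((r * n) !) (≤-trans (unique-inj-length code u (λ ω∈ → ∈-codes _ (proj₁ (h ω∈)) (proj₂ (h ω∈)))
        (λ _ _ → code-injective _ _)) (length-codes ws)) ⟩
    length ws * (c * (n ! * (r !) ^ n)) * (r * n) ! ≡⟨ lem (length ws) c (n !) ((r !) ^ n) ((r * n) !) ⟩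
    c * (r * n) ! * (length ws * ((r !) ^ n * n !))
      ≤⟨ *-monoˡ-≤ (length ws * ((r !) ^ n * n !)) (subst (λ z → c * (r * n) ! ≤ z ^ (r * n)) (length-allFin K)
        (length-combos (L.allFin K) (r * n))) ⟩
    K ^ (r * n) * (length ws * ((r !) ^ n * n !)) ∎
    where
    open ≤-Reasoning
    c = length (combos (L.allFin K) (r * n))
    lem : ∀ w c a b f → w * (c * (a * b)) * f ≡ c * f * (w * (b * a))
    lem = solve-∀

-- Decidability of twins and existence of the twin number

subset : ∀ {n} {P : Fin n → Set} → Decidable P → Subset n
subset P? = V.tabulate (λ a → Dec.does (P? a))

∈-subset⁺ : ∀ {n} {P : Fin n → Set} (P? : Decidable P) {a} → P a → a S.∈ subset P?
∈-subset⁺ P? {a} p = VP.lookup⇒[]= a (subset P?) (trans (VP.lookup∘tabulate _ a) (Dec.dec-true (P? a) p))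

∈-subset⁻ : ∀ {n} {P : Fin n → Set} (P? : Decidable P) {a} → a S.∈ subset P? → P a
∈-subset⁻ P? {a} a∈ with P? a | trans (sym (VP.lookup∘tabulate (λ b → Dec.does (P? b)) a)) (VP.[]=⇒lookup a∈)
... | yes p | _ = p
... | no _ | ()

length-filter-∈ : ∀ {n} (p : Subset n) → length (filter (SP._∈? p) (L.allFin n)) ≡ ∣ p ∣
length-filter-∈ [] = refl
length-filter-∈ {suc n} (s ∷ p) = split s
  where
  rest : ∀ s → length (filter (SP._∈? (s ∷ p)) (L.tabulate suc)) ≡ ∣ p ∣
  rest s = trans (cong (length ∘ filter (SP._∈? (s ∷ p))) (sym (LP.map-tabulate id suc)))
    (trans (length-filter-map (SP._∈? (s ∷ p)) (SP._∈? p) suc (λ _ → SP.drop-there) (λ _ → V.there) (L.allFin n))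
      (length-filter-∈ p))
  split : ∀ s → length (filter (SP._∈? (s ∷ p)) (L.allFin (suc n))) ≡ ∣ s ∷ p ∣
  split inside = cong suc (rest inside)
  split outside = rest outside

-- The search runs over tables of values. `P` has to respect pointwise equality because a function
-- agrees with its table only pointwise.
anyFunction? : ∀ {m k} {P : (Fin m → Fin k) → Set} → (∀ {f g} → (∀ i → f i ≡ g i) → P f → P g) →
  Decidable P → Dec (∃ P)
anyFunction? {m} {k} {P} P-resp P? = map′ to from (Any.any? (λ v → P? (V.lookup v)) (words k m))
  where
  to : Any (λ v → P (V.lookup v)) (words k m) → ∃ P
  to a = V.lookup (proj₁ (Any.satisfied a)) , proj₂ (Any.satisfied a)
  from : ∃ P → Any (λ v → P (V.lookup v)) (words k m)
  from (f , p) = lose (∈-words (V.tabulate f)) (P-resp (λ i → sym (VP.lookup∘tabulate f i)) p)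

module _ {m n : ℕ} (w : Word m n) where

  inSub? : ∀ p i → Dec (InSub w p i)
  inSub? p i = V.lookup w i SP.∈? p

  abstract
    isoSub? : ∀ p q → Dec (IsoSub w p q)
    isoSub? p q = anyFunction? iso-resp (λ f →
      FP.all? (λ i → inSub? p i →-dec inSub? q (f i)) ×-dec
      (FP.all? (λ i → FP.all? (λ j → inSub? p i →-dec (inSub? p j →-dec ((toℕ i <? toℕ j) →-dec (toℕ (f i) <? toℕ (f j)))))) ×-dec
      (FP.all? (λ j → inSub? q j →-dec FP.any? (λ i → inSub? p i ×-dec (f i FP.≟ j))) ×-dec
      FP.all? (λ i → FP.all? (λ j → inSub? p i →-dec (inSub? p j →-dec
        iff? (V.lookup w i FP.≟ V.lookup w j) (V.lookup w (f i) FP.≟ V.lookup w (f j))))))))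
      where
      iff? : {A B : Set} → Dec A → Dec B → Dec (A ⇔ B)
      iff? a? b? = map′ (uncurry mk⇔) (λ e → Equivalence.to e , Equivalence.from e) ((a? →-dec b?) ×-dec (b? →-dec a?))
      IsIso : (Fin m → Fin m) → Set
      IsIso f =
        (∀ i → InSub w p i → InSub w q (f i)) ×
        (∀ i j → InSub w p i → InSub w p j → toℕ i < toℕ j → toℕ (f i) < toℕ (f j)) ×
        (∀ j → InSub w q j → ∃ λ i → InSub w p i × (f i ≡ j)) ×
        (∀ i j → InSub w p i → InSub w p j → (V.lookup w i ≡ V.lookup w j) ⇔ (V.lookup w (f i) ≡ V.lookup w (f j)))
      iso-resp : ∀ {f g} → (∀ i → f i ≡ g i) → IsIso f → IsIso g
      iso-resp h (a , b , c , d) =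
        (λ i x → subst (InSub w q) (h i) (a i x)) ,
        (λ i j x y lt → subst₂ (λ s t → toℕ s < toℕ t) (h i) (h j) (b i j x y lt)) ,
        (λ j x → let i , y , e = c j x in i , y , trans (sym (h i)) e) ,
        (λ i j x y → subst₂ (λ s t → (V.lookup w i ≡ V.lookup w j) ⇔ (V.lookup w s ≡ V.lookup w t)) (h i) (h j) (d i j x y))

    twins? : ∀ k → Dec (Twins w k)
    twins? k = SP.anySubset? (λ p → SP.anySubset? (λ q →
      ¬? (SP.nonempty? (p S.∩ q)) ×-dec (isoSub? p q ×-dec (∣ p ∣ ≟ k))))

  no-twins : Twins w 0
  no-twins = S.⊥ , S.⊥ , (λ (x , x∈) → SP.∉⊥ (SP.p∩q⊆p S.⊥ S.⊥ x∈)) ,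
    (id , (λ _ x → x) , (λ _ _ _ _ lt → lt) , (λ j x → j , x , refl) , (λ _ _ _ _ → mk⇔ id id)) , SP.∣⊥∣≡0 n

  greatest : {P : ℕ → Set} → Decidable P → P 0 → ∀ b → ∃ λ k → P k × (∀ k′ → k′ ≤ b → P k′ → k′ ≤ k)
  greatest P? p₀ zero = 0 , p₀ , λ k le _ → le
  greatest {P} P? p₀ (suc b) with P? (suc b)
  ... | yes p = suc b , p , λ k le _ → le
  ... | no ¬p with greatest P? p₀ b
  ...   | k , p , max = k , p , bound
    where
    bound : ∀ k′ → k′ ≤ suc b → P k′ → k′ ≤ k
    bound k′ le p′ with m≤n⇒m<n∨m≡n le
    ... | inj₁ (s≤s le′) = max k′ le′ p′
    ... | inj₂ refl = ⊥-elim (¬p p′)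

  -- `Good` asks for the exact maximum, which is found by search: each size is decidable and none
  -- exceeds n.
  twinNumber : ∃ (TwinNumber w)
  twinNumber =
    let k , t , max = greatest twins? no-twins n
    in k , t , λ { k′ t′@(p , _ , _ , _ , refl) → max k′ (SP.∣p∣≤n p) t′ }

-- Twins expressed through labels

module TwinTransfer (K n r : ℕ) (1≤r : 1 ≤ r) where

  open Outcomes K n r 1≤r

  module _ (ω : Outcome) (tf : TieFree ω) where

    slot : Fin (r * n) → Slot
    slot = V.lookup (slotAt ω)

    pos : Slot → Fin (r * n)
    pos p = proj₁ (position ω p)

    slot-pos : ∀ p → slot (pos p) ≡ p
    slot-pos p = proj₂ (position ω p)

    slot-mono : ∀ {i j} → toℕ i < toℕ j → lab ω (slot i) F.< lab ω (slot j)
    slot-mono {i} {j} lt = subst₂ F._<_ (VP.lookup-map i (lab ω) (slotAt ω)) (VP.lookup-map j (lab ω) (slotAt ω))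
      (AllPairs-lookup (labels ω) (labels-increasing ω tf) lt)

    slot-reflects : ∀ {i j} → lab ω (slot i) F.< lab ω (slot j) → toℕ i < toℕ j
    slot-reflects {i} {j} lt with <-cmp (toℕ i) (toℕ j)
    ... | tri< l _ _ = l
    ... | tri≈ _ e _ rewrite FP.toℕ-injective {i = i} {j} e = ⊥-elim (<-irrefl refl lt)
    ... | tri> _ _ g = ⊥-elim (<-asym lt (slot-mono g))

    slot-injective : ∀ {i j} → slot i ≡ slot j → i ≡ j
    slot-injective {i} {j} e with <-cmp (toℕ i) (toℕ j)
    ... | tri≈ _ eq _ = FP.toℕ-injective eq
    ... | tri< l _ _ = ⊥-elim (<-irrefl (cong (toℕ ∘ lab ω) e) (slot-mono l))
    ... | tri> _ _ g = ⊥-elim (<-irrefl (cong (toℕ ∘ lab ω) (sym e)) (slot-mono g))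

    letter-injective : ∀ {j j′} → letter ω j ≡ letter ω j′ → j ≡ j′
    letter-injective {j} {j′} e = trans (sym (edge-letter ω j)) (trans (cong (edge ω) e) (edge-letter ω j′))

    owner : Fin (r * n) → Fin n
    owner i = proj₁ (slot i)

    word-owner : ∀ {i j} → V.lookup (word ω) i ≡ V.lookup (word ω) j → owner i ≡ owner j
    word-owner {i} {j} e = letter-injective (trans (sym (lookup-word ω i)) (trans e (lookup-word ω j)))

    owner-word : ∀ {i j} → owner i ≡ owner j → V.lookup (word ω) i ≡ V.lookup (word ω) j
    owner-word {i} {j} e = trans (lookup-word ω i) (trans (cong (letter ω) e) (sym (lookup-word ω j)))

    module _ {t} (σ τ : Fin t → Fin n) (σ-inj : ∀ {i j} → σ i ≡ σ j → i ≡ j) (τ-inj : ∀ {i j} → τ i ≡ τ j → i ≡ j)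
             (σ≢τ : ∀ i j → σ i ≢ τ j)
             (mono : ∀ i s j s′ → lab ω (σ i , s) F.< lab ω (σ j , s′) → lab ω (τ i , s) F.< lab ω (τ j , s′)) where

      private
        image? : (ρ : Fin t → Fin n) → Decidable (λ a → ∃ λ i → letter ω (ρ i) ≡ a)
        image? ρ a = FP.any? (λ i → letter ω (ρ i) FP.≟ a)

        image : (Fin t → Fin n) → Subset n
        image ρ = subset (image? ρ)

        owner∈ : ∀ {ρ i} k → owner i ≡ ρ k → InSub (word ω) (image ρ) i
        owner∈ {ρ} {i} k e = ∈-subset⁺ (image? ρ) (k , sym (trans (lookup-word ω i) (cong (letter ω) e)))

        ∈owner : ∀ {ρ i} → InSub (word ω) (image ρ) i → ∃ λ k → owner i ≡ ρ k
        ∈owner {ρ} {i} i∈ with ∈-subset⁻ (image? ρ) i∈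
        ... | k , e = k , letter-injective (trans (sym (lookup-word ω i)) (sym e))

        -- Off the edges of σ the value is an arbitrary default: `IsoSub` constrains its map only on
        -- the first sub-matching.
        partner : Slot → Slot
        partner (j , s) with FP.any? (λ k → σ k FP.≟ j)
        ... | yes (k , _) = τ k , s
        ... | no _ = j , s

        partner-σ : ∀ k s → partner (σ k , s) ≡ (τ k , s)
        partner-σ k s with FP.any? (λ k′ → σ k′ FP.≟ σ k)
        ... | yes (k′ , e) = cong (λ z → τ z , s) (σ-inj e)
        ... | no ¬e = ⊥-elim (¬e (k , refl))

        f : Fin (r * n) → Fin (r * n)
        f i = pos (partner (slot i))

        slot-f : ∀ {i} k → owner i ≡ σ k → slot (f i) ≡ (τ k , proj₂ (slot i))
        slot-f {i} k e = trans (slot-pos _) (trans (cong (λ z → partner (z , proj₂ (slot i))) e) (partner-σ k (proj₂ (slot i))))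

        slot-split : ∀ {i j} → owner i ≡ j → slot i ≡ (j , proj₂ (slot i))
        slot-split refl = refl

        f-mono : ∀ i j → InSub (word ω) (image σ) i → InSub (word ω) (image σ) j → toℕ i < toℕ j → toℕ (f i) < toℕ (f j)
        f-mono i j i∈ j∈ lt with ∈owner i∈ | ∈owner j∈
        ... | k , e | k′ , e′ = slot-reflects (subst₂ (λ x y → lab ω x F.< lab ω y) (sym (slot-f k e)) (sym (slot-f k′ e′))
          (mono k _ k′ _ (subst₂ (λ x y → lab ω x F.< lab ω y) (slot-split e) (slot-split e′) (slot-mono lt))))

        f-onto : ∀ j → InSub (word ω) (image τ) j → ∃ λ i → InSub (word ω) (image σ) i × (f i ≡ j)
        f-onto j j∈ with ∈owner j∈
        ... | k , e = i , owner∈ k ei ,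
          slot-injective (trans (slot-f k ei) (trans (cong (λ z → τ k , proj₂ z) (slot-pos _)) (sym (slot-split e))))
          where
          i = pos (σ k , proj₂ (slot j))
          ei : owner i ≡ σ k
          ei = cong proj₁ (slot-pos _)

        f-iff : ∀ i j → InSub (word ω) (image σ) i → InSub (word ω) (image σ) j →
          (V.lookup (word ω) i ≡ V.lookup (word ω) j) ⇔ (V.lookup (word ω) (f i) ≡ V.lookup (word ω) (f j))
        f-iff i j i∈ j∈ with ∈owner i∈ | ∈owner j∈
        ... | k , e | k′ , e′ = mk⇔
          (λ eq → owner-word (trans (cong proj₁ (slot-f k e))
            (trans (cong τ (σ-inj (trans (sym e) (trans (word-owner eq) e′)))) (sym (cong proj₁ (slot-f k′ e′))))))
          (λ eq → owner-word (trans e (trans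
            (cong σ (τ-inj (trans (sym (cong proj₁ (slot-f k e)))
            (trans (word-owner eq) (cong proj₁ (slot-f k′ e′)))))) (sym e′))))

        size : ∣ image σ ∣ ≡ t
        size = trans (sym (length-filter-∈ (image σ))) (≤-antisym
          (≤-trans (unique-⊆-length (UP.filter⁺ (SP._∈? image σ) (UP.allFin⁺ n)) into) (≤-reflexive len))
          (≤-trans (≤-reflexive (sym len)) (unique-⊆-length (UP.map⁺ (σ-inj ∘ letter-injective) (UP.allFin⁺ t)) from)))
          where
          list = L.map (letter ω ∘ σ) (L.allFin t)
          len : length list ≡ t
          len = trans (LP.length-map _ (L.allFin t)) (length-allFin t)
          into : ∀ {a} → a ∈ filter (SP._∈? image σ) (L.allFin n) → a ∈ list
          into a∈ with ∈-subset⁻ (image? σ) (proj₂ (∈-filter⁻ (SP._∈? image σ) {xs = L.allFin n} a∈))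
          ... | i , refl = ∈-map⁺ (letter ω ∘ σ) (∈-allFin i)
          from : ∀ {a} → a ∈ list → a ∈ filter (SP._∈? image σ) (L.allFin n)
          from a∈ with ∈-map⁻ (letter ω ∘ σ) a∈
          ... | i , _ , refl = ∈-filter⁺ (SP._∈? image σ) (∈-allFin _) (∈-subset⁺ (image? σ) (i , refl))

      -- Without ties positions are ordered as labels are, so by `mono` sending slot s of `σ k` to
      -- slot s of `τ k` is an isomorphism.
      twins-from-slots : Twins (word ω) t
      twins-from-slots = image σ , image τ , disjoint ,
        (f , (λ i i∈ → let k , e = ∈owner i∈ in owner∈ k (cong proj₁ (slot-f k e))) , f-mono , f-onto , f-iff) , size
        where
        disjoint : S.Empty (image σ S.∩ image τ)
        disjoint (a , a∈) with SP.x∈p∩q⁻ (image σ) (image τ) a∈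
        ... | a∈σ , a∈τ with ∈-subset⁻ (image? σ) a∈σ | ∈-subset⁻ (image? τ) a∈τ
        ...   | i , e | j , e′ = σ≢τ i j (letter-injective (trans e (sym e′)))

  -- Slots of an edge are mere names, so an isomorphism may permute them; `π i` records how.
  -- Surjectivity of each `π i` ensures that all labels of τ can be recovered from those listed
  -- along σ.
  Twisted : ∀ {t} → Vec (Fin n) t → Vec (Fin n) t → Vec (Vec (Fin r) r) t → Outcome → Set
  Twisted σ τ π ω =
    (∀ i j → V.lookup σ i ≡ V.lookup σ j → i ≡ j) ×
    (∀ i j → V.lookup τ i ≡ V.lookup τ j → i ≡ j) ×
    (∀ i j → V.lookup σ i ≢ V.lookup τ j) ×
    (∀ i s → ∃ λ s′ → V.lookup (V.lookup π i) s′ ≡ s) ×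
    (∀ i s j s′ → lab ω (V.lookup σ i , s) F.< lab ω (V.lookup σ j , s′) →
      lab ω (V.lookup τ i , V.lookup (V.lookup π i) s) F.< lab ω (V.lookup τ j , V.lookup (V.lookup π j) s′))

  twisted? : ∀ {t} (σ τ : Vec (Fin n) t) π ω → Dec (Twisted σ τ π ω)
  twisted? σ τ π ω =
    FP.all? (λ i → FP.all? (λ j → (V.lookup σ i FP.≟ V.lookup σ j) →-dec (i FP.≟ j))) ×-dec
    (FP.all? (λ i → FP.all? (λ j → (V.lookup τ i FP.≟ V.lookup τ j) →-dec (i FP.≟ j))) ×-dec
    (FP.all? (λ i → FP.all? (λ j → ¬? (V.lookup σ i FP.≟ V.lookup τ j))) ×-dec
    (FP.all? (λ i → FP.all? (λ s → FP.any? (λ s′ → V.lookup (V.lookup π i) s′ FP.≟ s))) ×-dec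
    FP.all? (λ i → FP.all? (λ s → FP.all? (λ j → FP.all? (λ s′ →
      (lab ω (V.lookup σ i , s) FP.<? lab ω (V.lookup σ j , s′)) →-dec
      (lab ω (V.lookup τ i , V.lookup (V.lookup π i) s) FP.<? lab ω (V.lookup τ j , V.lookup (V.lookup π j) s′)))))))))

  -- Twins of any size k ≥ t are cut down to t edges, so a single t controls all larger twins.
  -- Choosing σ as a sublist of `L.allFin n` fixes its order, which saves t! choices.
  twisted-from-twins : ∀ ω → TieFree ω → ∀ {k t} → Twins (word ω) k → t ≤ k →
    ∃ λ σ → ∃ λ τ → ∃ λ π → σ ∈ combos (L.allFin n) t × Twisted σ τ π ω
  twisted-from-twins ω tf {k} {t} (p , q , p∩q=∅ , (f , into , mono , onto , iff) , refl) t≤k =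
    σ , V.tabulate τ , V.tabulate (λ i → V.tabulate (π i)) , ∈-combos σ σ⊆ ,
    (λ i j → σ-inj) ,
    (λ i j e → τ-inj (trans (sym (VP.lookup∘tabulate τ i)) (trans e (VP.lookup∘tabulate τ j)))) ,
    (λ i j e → σ≢τ i j (trans e (VP.lookup∘tabulate τ j))) ,
    (λ i s → let s′ , e = π-onto i s in s′ , trans (lookup-π i s′) e) ,
    (λ i s j s′ lt → subst₂ (λ x y → lab ω x F.< lab ω y) (sym (target i s)) (sym (target j s′)) (π-mono i s j s′ lt))
    where
    member? : Decidable (λ j → letter ω j S.∈ p)
    member? j = letter ω j SP.∈? p
    members : List (Fin n)
    members = filter member? (L.allFin n)
    k≤members : k ≤ length members
    k≤members = subst (_≤ length members) (length-filter-∈ p) (unique-inj-length (edge ω)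
      (UP.filter⁺ (SP._∈? p) (UP.allFin⁺ n))
      (λ {a} a∈ → ∈-filter⁺ member? (∈-allFin _)
        (subst (S._∈ p) (sym (letter-edge ω a)) (proj₂ (∈-filter⁻ (SP._∈? p) {xs = L.allFin n} a∈))))
      (λ _ _ → edge-injective ω))
    σ : Vec (Fin n) t
    σ = toVec (L.take t members) (trans (LP.length-take t members) (m≤n⇒m⊓n≡m (≤-trans t≤k k≤members)))
    toList-σ : V.toList σ ≡ L.take t members
    toList-σ = toList-toVec _ _
    σ⊆ : V.toList σ ⊆ L.allFin n
    σ⊆ = subst (_⊆ L.allFin n) (sym toList-σ) (⊆-trans (SLP.take-⊆ t members) (SLP.filter-⊆ member? (L.allFin n)))
    σ-inj : ∀ {i j} → V.lookup σ i ≡ V.lookup σ j → i ≡ j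
    σ-inj {i} {j} e with <-cmp (toℕ i) (toℕ j)
    ... | tri≈ _ eq _ = FP.toℕ-injective eq
    ... | tri< l _ _ = ⊥-elim (AllPairs-lookup σ σ-unique l e)
      where σ-unique = subst Unique (sym toList-σ) (UP.take⁺ t (UP.filter⁺ member? (UP.allFin⁺ n)))
    ... | tri> _ _ g = ⊥-elim (AllPairs-lookup σ σ-unique g (sym e))
      where σ-unique = subst Unique (sym toList-σ) (UP.take⁺ t (UP.filter⁺ member? (UP.allFin⁺ n)))
    σ∈ : ∀ i → letter ω (V.lookup σ i) S.∈ p
    σ∈ i = proj₂ (∈-filter⁻ member? {xs = L.allFin n}
      (SLP.Any-resp-⊆ (SLP.take-⊆ t members) (subst (V.lookup σ i ∈_) toList-σ (lookup∈toList σ i))))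
    at : Fin t → Fin r → Fin (r * n)
    at i s = pos ω tf (V.lookup σ i , s)
    slot-at : ∀ i s → slot ω tf (at i s) ≡ (V.lookup σ i , s)
    slot-at i s = proj₂ (position ω _)
    word-at : ∀ i s → V.lookup (word ω) (at i s) ≡ letter ω (V.lookup σ i)
    word-at i s = trans (lookup-word ω (at i s)) (cong (letter ω ∘ proj₁) (slot-at i s))
    at∈ : ∀ i s → InSub (word ω) p (at i s)
    at∈ i s = subst (S._∈ p) (sym (word-at i s)) (σ∈ i)
    s₀ : Fin r
    s₀ = F.fromℕ< 1≤r
    τ : Fin t → Fin n
    τ i = proj₁ (slot ω tf (f (at i s₀)))
    π : Fin t → Fin r → Fin r
    π i s = proj₂ (slot ω tf (f (at i s)))
    letter-inj : ∀ {j j′} → letter ω j ≡ letter ω j′ → j ≡ j′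
    letter-inj = letter-injective ω tf
    -- The edge clause of the isomorphism sends all slots of one edge to one edge, so its name can
    -- be read at the reference slot `s₀`.
    owner-f : ∀ i s → proj₁ (slot ω tf (f (at i s))) ≡ τ i
    owner-f i s = letter-inj (trans (sym (lookup-word ω _)) (trans
      (Equivalence.to (iff (at i s) (at i s₀) (at∈ i s) (at∈ i s₀)) (trans (word-at i s) (sym (word-at i s₀))))
      (lookup-word ω _)))
    slot-f : ∀ i s → slot ω tf (f (at i s)) ≡ (τ i , π i s)
    slot-f i s = cong (_, π i s) (owner-f i s)
    lookup-π : ∀ i s → V.lookup (V.lookup (V.tabulate (λ i → V.tabulate (π i))) i) s ≡ π i s
    lookup-π i s = trans (cong (λ v → V.lookup v s) (VP.lookup∘tabulate (λ i → V.tabulate (π i)) i)) (VP.lookup∘tabulate (π i) s)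
    target : ∀ i s → (V.lookup (V.tabulate τ) i , V.lookup (V.lookup (V.tabulate (λ i → V.tabulate (π i))) i) s) ≡
      slot ω tf (f (at i s))
    target i s = trans (cong₂ _,_ (VP.lookup∘tabulate τ i) (lookup-π i s)) (sym (slot-f i s))
    τ-word : ∀ i → V.lookup (word ω) (f (at i s₀)) ≡ letter ω (τ i)
    τ-word i = lookup-word ω _
    τ-inj : ∀ {i j} → τ i ≡ τ j → i ≡ j
    τ-inj {i} {j} e = σ-inj (letter-inj (trans (sym (word-at i s₀)) (trans
      (Equivalence.from (iff (at i s₀) (at j s₀) (at∈ i s₀) (at∈ j s₀))
        (trans (τ-word i) (trans (cong (letter ω) e) (sym (τ-word j)))))
      (word-at j s₀))))
    σ≢τ : ∀ i j → V.lookup σ i ≢ τ j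
    σ≢τ i j e = p∩q=∅ (letter ω (V.lookup σ i) , SP.x∈p∩q⁺ (σ∈ i ,
      subst (S._∈ q) (trans (τ-word j) (cong (letter ω) (sym e))) (into (at j s₀) (at∈ j s₀))))
    -- The position of slot s of `τ i` has a preimage x in the first sub-matching; the edge clause
    -- read backwards puts x on the i-th edge of σ.
    π-onto : ∀ i s → ∃ λ s′ → π i s′ ≡ s
    π-onto i s with onto (pos ω tf (τ i , s))
      (subst (S._∈ q) (trans (τ-word i) (trans (cong (letter ω ∘ proj₁) (sym (proj₂ (position ω (τ i , s)))))
      (sym (lookup-word ω _)))) (into (at i s₀) (at∈ i s₀)))
    ... | x , x∈ , fx = proj₂ (slot ω tf x) , trans (cong (λ y → proj₂ (slot ω tf (f y))) same)
      (trans (cong (proj₂ ∘ slot ω tf) fx) (cong proj₂ (proj₂ (position ω (τ i , s)))))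
      where
      owner-x : proj₁ (slot ω tf x) ≡ V.lookup σ i
      owner-x = letter-inj (trans (sym (lookup-word ω x)) (trans
        (Equivalence.from (iff x (at i s₀) x∈ (at∈ i s₀))
          (trans (cong (V.lookup (word ω)) fx)
          (trans (lookup-word ω _) (trans (cong (letter ω ∘ proj₁) (proj₂ (position ω (τ i , s)))) (sym (τ-word i))))))
        (word-at i s₀)))
      same : at i (proj₂ (slot ω tf x)) ≡ x
      same = slot-injective ω tf (trans (slot-at i _) (cong (_, proj₂ (slot ω tf x)) (sym owner-x)))
    π-mono : ∀ i s j s′ → lab ω (V.lookup σ i , s) F.< lab ω (V.lookup σ j , s′) →
      lab ω (slot ω tf (f (at i s))) F.< lab ω (slot ω tf (f (at j s′)))
    π-mono i s j s′ lt = slot-mono ω tf (mono (at i s) (at j s′) (at∈ i s) (at∈ j s′)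
      (slot-reflects ω tf (subst₂ (λ x y → lab ω x F.< lab ω y) (sym (slot-at i s)) (sym (slot-at j s′)) lt)))

-- From pairs of edges with a common box to twins

module LowerTransfer (N Q n r : ℕ) (1≤r : 1 ≤ r) where

  open Outcomes (N * Q) n r 1≤r
  open Boxes N r
  open TwinTransfer (N * Q) n r 1≤r using (twins-from-slots)

  boxOf : Outcome → Vec Box n
  boxOf = V.map (V.map (F.quotient Q))

  lookup-boxOf : ∀ ω j s → V.lookup (V.lookup (boxOf ω) j) s ≡ F.quotient Q (lab ω (j , s))
  lookup-boxOf ω j s = trans (cong (λ v → V.lookup v s) (VP.lookup-map j (V.map (F.quotient Q)) ω))
    (VP.lookup-map s (F.quotient Q) (V.lookup ω j))

  quotient-reflects-< : ∀ (x y : Fin (N * Q)) → F.quotient {N} Q x F.< F.quotient {N} Q y → x F.< y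
  quotient-reflects-< x y lt = subst₂ F._<_ (FP.combine-remQuot {N} Q x) (FP.combine-remQuot {N} Q y)
    (FP.combine-monoˡ-< (F.remainder {N} Q x) (F.remainder {N} Q y) lt)

  quotient-<-≢ : ∀ (x y : Fin (N * Q)) → x F.< y → F.quotient {N} Q x ≢ F.quotient {N} Q y →
    F.quotient {N} Q x F.< F.quotient {N} Q y
  quotient-<-≢ x y lt ne with FP.<-cmp (F.quotient {N} Q x) (F.quotient {N} Q y)
  ... | tri< l _ _ = l
  ... | tri≈ _ e _ = ⊥-elim (ne e)
  ... | tri> _ _ g = ⊥-elim (<-asym lt (quotient-reflects-< y x g))

  twins-from-pairing : ∀ {T} ω → TieFree ω → Pairing (boxOf ω) T → ∃ λ t → T ≤ t × Twins (word ω) t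
  twins-from-pairing ω tf (pairing used enough injective disjoint twice) =
    length used , enough , twins-from-slots ω tf σ τ (separate σ σ-box) (separate τ τ-box) σ≢τ mono
    where
    U : Vec Box (length used)
    U = V.fromList used
    B : Fin (length used) → Box
    B = V.lookup U
    B∈ : ∀ i → B i ∈ used
    B∈ i = subst (B i ∈_) (VP.toList∘fromList used) (lookup∈toList U i)
    σ τ : Fin (length used) → Fin n
    σ i = proj₁ (All.lookup twice (B∈ i))
    τ i = proj₁ (proj₂ (All.lookup twice (B∈ i)))
    σ-box : ∀ i → V.lookup (boxOf ω) (σ i) ≡ B i
    σ-box i = proj₁ (proj₂ (proj₂ (All.lookup twice (B∈ i))))
    τ-box : ∀ i → V.lookup (boxOf ω) (τ i) ≡ B i
    τ-box i = proj₁ (proj₂ (proj₂ (proj₂ (All.lookup twice (B∈ i)))))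
    apart : ∀ {i j} → i ≢ j → Disjoint (B i) (B j)
    apart {i} {j} ne with FP.<-cmp i j
    ... | tri< l _ _ = AllPairs-lookup U (subst (AllPairs Disjoint) (sym (VP.toList∘fromList used)) disjoint) l
    ... | tri≈ _ e _ = ⊥-elim (ne e)
    ... | tri> _ _ g = λ s s′ e → AllPairs-lookup U
      (subst (AllPairs Disjoint) (sym (VP.toList∘fromList used)) disjoint) g s′ s (sym e)
    same : ∀ {i j} → B i ≡ B j → i ≡ j
    same {i} {j} e with i FP.≟ j
    ... | yes eq = eq
    ... | no ne = ⊥-elim (apart ne s₀ s₀ (cong (λ b → V.lookup b s₀) e))
      where
      s₀ : Fin r
      s₀ = F.fromℕ< 1≤r
    separate : (ρ : Fin (length used) → Fin n) → (∀ i → V.lookup (boxOf ω) (ρ i) ≡ B i) → ∀ {i j} → ρ i ≡ ρ j → i ≡ j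
    separate ρ h {i} {j} e = same (trans (sym (h i)) (trans (cong (V.lookup (boxOf ω)) e) (h j)))
    σ≢τ : ∀ i j → σ i ≢ τ j
    σ≢τ i j e with same {i} {j} (trans (sym (σ-box i)) (trans (cong (V.lookup (boxOf ω)) e) (τ-box j)))
    ... | refl = proj₂ (proj₂ (proj₂ (proj₂ (All.lookup twice (B∈ i))))) e
    quot : (ρ : Fin (length used) → Fin n) → (∀ i → V.lookup (boxOf ω) (ρ i) ≡ B i) → ∀ i s →
      F.quotient {N} Q (lab ω (ρ i , s)) ≡ V.lookup (B i) s
    quot ρ h i s = trans (sym (lookup-boxOf ω (ρ i) s)) (cong (λ b → V.lookup b s) (h i))
    -- Labels in different intervals are ordered as the intervals, and these are the same for σ and
    -- τ. Equal intervals occur only when both labels belong to one slot, which `lt` excludes.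
    mono : ∀ i s j s′ → lab ω (σ i , s) F.< lab ω (σ j , s′) → lab ω (τ i , s) F.< lab ω (τ j , s′)
    mono i s j s′ lt = quotient-reflects-< _ _ (subst₂ F._<_
      (trans (quot σ σ-box i s) (sym (quot τ τ-box i s))) (trans (quot σ σ-box j s′) (sym (quot τ τ-box j s′)))
      (quotient-<-≢ _ _ lt (λ e → differ (trans (sym (quot σ σ-box i s)) (trans e (quot σ σ-box j s′))))))
      where
      differ : V.lookup (B i) s ≢ V.lookup (B j) s′
      differ e with i FP.≟ j
      ... | no ne = apart ne s s′ e
      ... | yes refl with VUP.lookup-injective (All.lookup injective (B∈ i)) s s′ e
      ...   | refl = <-irrefl refl lt

  refine : Vec Box n → Vec (Vec (Fin Q) r) n → Outcome
  refine = V.zipWith (V.zipWith F.combine)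

  refinements : List (Vec Box n) → List Outcome
  refinements βs = cartesianProductWith refine βs (vecs (words Q r) n)

  ∈-refinements : ∀ {βs} ω → boxOf ω ∈ βs → ω ∈ refinements βs
  ∈-refinements {βs} ω β∈ = subst (_∈ refinements βs) (refine-boxOf)
    (∈-cartesianProductWith⁺ refine β∈ (∈-vecs rem (λ _ → ∈-words _)))
    where
    rem : Vec (Vec (Fin Q) r) n
    rem = V.map (V.map (F.remainder {N} Q)) ω
    refine-boxOf : refine (boxOf ω) rem ≡ ω
    refine-boxOf = vec-ext _ _ (λ j → vec-ext _ _ (λ s → begin
      V.lookup (V.lookup (refine (boxOf ω) rem) j) s
        ≡⟨ cong (λ v → V.lookup v s) (VP.lookup-zipWith (V.zipWith F.combine) j (boxOf ω) rem) ⟩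
      V.lookup (V.zipWith F.combine (V.lookup (boxOf ω) j) (V.lookup rem j)) s
        ≡⟨ VP.lookup-zipWith F.combine s (V.lookup (boxOf ω) j) (V.lookup rem j) ⟩
      F.combine (V.lookup (V.lookup (boxOf ω) j) s) (V.lookup (V.lookup rem j) s)
        ≡⟨ cong₂ F.combine (lookup-boxOf ω j s)
          (trans (cong (λ v → V.lookup v s) (VP.lookup-map j _ ω))
          (VP.lookup-map s (F.remainder {N} Q) (V.lookup ω j))) ⟩
      F.combine (F.quotient {N} Q (lab ω (j , s))) (F.remainder {N} Q (lab ω (j , s))) ≡⟨ FP.combine-remQuot {N} Q
        (lab ω (j , s)) ⟩
      lab ω (j , s) ∎))
      where open ≡-Reasoning

  -- Each box vector has the same number Q^(rn) of refinements, so a probability bound for boxes is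
  -- one for outcomes.
  length-refinements : ∀ c d βs → c * length βs ≤ d * (N ^ r) ^ n → c * length (refinements βs) ≤ d * (N * Q) ^ (r * n)
  length-refinements c d βs h = begin
    c * length (refinements βs) ≡⟨ cong (c *_)
      (trans (length-cartesianProductWith refine βs _)
      (cong (length βs *_) (trans (length-vecs (words Q r) n) (cong (_^ n) (length-words Q r))))) ⟩
    c * (length βs * (Q ^ r) ^ n) ≡⟨ sym (*-assoc c _ _) ⟩
    c * length βs * (Q ^ r) ^ n ≤⟨ *-monoˡ-≤ ((Q ^ r) ^ n) h ⟩
    d * (N ^ r) ^ n * (Q ^ r) ^ n ≡⟨ cong₂ (λ x y → d * x * y) (^-*-assoc N r n) (^-*-assoc Q r n) ⟩
    d * N ^ (r * n) * Q ^ (r * n) ≡⟨ *-assoc d _ _ ⟩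
    d * (N ^ (r * n) * Q ^ (r * n)) ≡⟨ cong (d *_) (sym (^-distribʳ-* N Q (r * n))) ⟩
    d * (N * Q) ^ (r * n) ∎
    where open ≤-Reasoning

-- First-moment bound for large twins

module UpperCount (K n r : ℕ) (1≤r : 1 ≤ r) (1≤K : 1 ≤ K) where

  open Outcomes K n r 1≤r
  open TwinTransfer K n r 1≤r using (Twisted; twisted?; twisted-from-twins)

  outcomes : List Outcome
  outcomes = vecs (words K r) n

  ∈-outcomes : ∀ ω → ω ∈ outcomes
  ∈-outcomes ω = ∈-vecs ω (λ _ → ∈-words _)

  outcomes-unique : Unique outcomes
  outcomes-unique = vecs-unique (words-unique K r) n

  length-outcomes : length outcomes ≡ K ^ (r * n)
  length-outcomes = trans (length-vecs (words K r) n) (trans (cong (_^ n) (length-words K r)) (^-*-assoc K r n))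

  module Fixed {t : ℕ} (σ τ : Vec (Fin n) t) (π : Vec (Vec (Fin r) r) t) where

    private
      module Sub = Outcomes K t r 1≤r

    bad? : Decidable (λ ω → Twisted σ τ π ω × VU.Unique (V.concat ω))
    bad? ω = twisted? σ τ π ω ×-dec uniqueVec? (V.concat ω)

    bad : List Outcome
    bad = filter bad? outcomes

    restrict : Outcome → Sub.Outcome
    restrict ω = V.map (V.lookup ω) σ

    lab-restrict : ∀ ω i s → Sub.lab (restrict ω) (i , s) ≡ lab ω (V.lookup σ i , s)
    lab-restrict ω i s = cong (λ v → V.lookup v s) (VP.lookup-map i (V.lookup ω) σ)

    fill : Outcome → Sub.Outcome → Fin n → Vec (Fin K) r
    fill ω z j with FP.any? (λ i → V.lookup τ i FP.≟ j)
    ... | yes (i , _) = V.lookup z i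
    ... | no _ = V.lookup ω j

    fill-τ : ∀ ω z → (∀ i j → V.lookup τ i ≡ V.lookup τ j → i ≡ j) → ∀ i → fill ω z (V.lookup τ i) ≡ V.lookup z i
    fill-τ ω z inj i with FP.any? (λ i′ → V.lookup τ i′ FP.≟ V.lookup τ i)
    ... | yes (i′ , e) = cong (V.lookup z) (inj i′ i e)
    ... | no ¬e = ⊥-elim (¬e (i , refl))

    fill-other : ∀ ω z j → (∀ i → V.lookup τ i ≢ j) → fill ω z j ≡ V.lookup ω j
    fill-other ω z j h with FP.any? (λ i → V.lookup τ i FP.≟ j)
    ... | yes (i , e) = ⊥-elim (h i e)
    ... | no _ = refl

    image : Fin t × Fin r → Slot
    image (i , s) = V.lookup τ i , V.lookup (V.lookup π i) s

    readOff : Outcome → Vec (Fin K) (r * t)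
    readOff ω = V.map (lab ω ∘ image) (Sub.slotAt (restrict ω))

    readOff-increasing : ∀ ω → Twisted σ τ π ω → TieFree ω → AllPairs F._<_ (V.toList (readOff ω))
    readOff-increasing ω (σ-inj , _ , _ , _ , mono) tf =
      subst (AllPairs F._<_) (sym (trans (VP.toList-map (lab ω ∘ image) (Sub.slotAt (restrict ω)))
        (cong (L.map (lab ω ∘ image)) (Sub.toList-slotAt (restrict ω)))))
        (APP.map⁺ (AP.map step (APP.map⁻ (Sub.sorted-increasing (restrict ω) sub-tf))))
      where
      sub-tf : Sub.TieFree (restrict ω)
      sub-tf {i , s} {j , s′} e with tf {V.lookup σ i , s} {V.lookup σ j , s′}
        (trans (sym (lab-restrict ω i s)) (trans e (lab-restrict ω j s′)))
      ... | eq = cong₂ _,_ (σ-inj i j (cong proj₁ eq)) (cong proj₂ eq)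
      step : ∀ {p q} → Sub.lab (restrict ω) p F.< Sub.lab (restrict ω) q → lab ω (image p) F.< lab ω (image q)
      step {i , s} {j , s′} lt = mono i s j s′ (subst₂ F._<_ (lab-restrict ω i s) (lab-restrict ω j s′) lt)

    -- Overwriting the edges of τ by arbitrary z loses only the increasing list of their labels,
    -- because the order in which the labels are assigned is dictated by the edges of σ.
    exchange : Outcome × Sub.Outcome → Outcome × Vec (Fin K) (r * t)
    exchange (ω , z) = V.tabulate (fill ω z) , readOff ω

    exchange-injective : ∀ {ω z ω′ z′} → Twisted σ τ π ω → Twisted σ τ π ω′ →
      exchange (ω , z) ≡ exchange (ω′ , z′) → (ω , z) ≡ (ω′ , z′)
    exchange-injective {ω} {z} {ω′} {z′} (_ , τ-inj , σ≢τ , onto , _) _ eq = cong₂ _,_ (vec-ext ω ω′ same-edge)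
      (vec-ext z z′ same-z)
      where
      same-fill : ∀ j → fill ω z j ≡ fill ω′ z′ j
      same-fill j = trans (sym (VP.lookup∘tabulate (fill ω z) j))
        (trans (cong (λ v → V.lookup (proj₁ v) j) eq) (VP.lookup∘tabulate (fill ω′ z′) j))
      same-z : ∀ i → V.lookup z i ≡ V.lookup z′ i
      same-z i = trans (sym (fill-τ ω z τ-inj i)) (trans (same-fill (V.lookup τ i)) (fill-τ ω′ z′ τ-inj i))
      -- σ avoids τ, so its labels survive the overwriting.
      same-restrict : restrict ω ≡ restrict ω′
      same-restrict = vec-ext _ _ (λ i → trans (VP.lookup-map i (V.lookup ω) σ) (trans
        (trans (sym (fill-other ω z _ (λ i′ e → σ≢τ i i′ (sym e))))
          (trans (same-fill _) (fill-other ω′ z′ _ (λ i′ e → σ≢τ i i′ (sym e)))))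
        (sym (VP.lookup-map i (V.lookup ω′) σ))))
      same-image : ∀ p → lab ω (image p) ≡ lab ω′ (image p)
      same-image p with Sub.position (restrict ω) p
      ... | i , refl = trans (sym (VP.lookup-map i (lab ω ∘ image) (Sub.slotAt (restrict ω))))
        (trans (cong (λ v → V.lookup (proj₂ v) i) eq)
        (trans (VP.lookup-map i (lab ω′ ∘ image) (Sub.slotAt (restrict ω′)))
          (cong (λ y → lab ω′ (image (V.lookup (Sub.slotAt y) i))) (sym same-restrict))))
      same-edge : ∀ j → V.lookup ω j ≡ V.lookup ω′ j
      same-edge j with FP.any? (λ i → V.lookup τ i FP.≟ j)
      ... | no ¬e = trans (sym (fill-other ω z j (λ i e → ¬e (i , e))))
        (trans (same-fill j) (fill-other ω′ z′ j (λ i e → ¬e (i , e))))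
      ... | yes (i , refl) = vec-ext _ _ same-label
        where
        same-label : ∀ s → V.lookup (V.lookup ω (V.lookup τ i)) s ≡ V.lookup (V.lookup ω′ (V.lookup τ i)) s
        same-label s with onto i s
        ... | s′ , refl = same-image (i , s′)

    -- Injectivity of `exchange` gives |bad| K^(rt) ≤ K^(rn) C(K, rt), and C(K, rt) (rt)! ≤ K^(rt).
    length-bad : (r * t) ! * length bad ≤ K ^ (r * n)
    length-bad = *-cancelʳ-≤ _ _ (K ^ (r * t)) (begin
      (r * t) ! * length bad * K ^ (r * t) ≡⟨ *-assoc ((r * t) !) _ _ ⟩
      (r * t) ! * (length bad * K ^ (r * t)) ≡⟨ cong (λ y → (r * t) ! * (length bad * y)) (sym len-z) ⟩
      (r * t) ! * (length bad * length zs) ≡⟨ cong ((r * t) ! *_) (sym (length-cartesianProductWith _,_ bad zs)) ⟩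
      (r * t) ! * length (cartesianProduct bad zs)
        ≤⟨ *-monoʳ-≤ ((r * t) !) (unique-inj-length exchange
          (UP.cartesianProduct⁺ (UP.filter⁺ bad? outcomes-unique) (vecs-unique (words-unique K r) t)) into inj) ⟩
      (r * t) ! * length (cartesianProduct outcomes cs) ≡⟨ cong ((r * t) ! *_)
        (trans (length-cartesianProductWith _,_ outcomes cs) (cong (_* length cs) length-outcomes)) ⟩
      (r * t) ! * (K ^ (r * n) * length cs) ≡⟨ lem ((r * t) !) (K ^ (r * n)) (length cs) ⟩
      K ^ (r * n) * (length cs * (r * t) !) ≤⟨ *-monoʳ-≤ (K ^ (r * n))
        (subst (λ y → length cs * (r * t) ! ≤ y ^ (r * t)) (length-allFin K) (length-combos (L.allFin K) (r * t))) ⟩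
      K ^ (r * n) * K ^ (r * t) ∎)
      where
      open ≤-Reasoning
      zs : List Sub.Outcome
      zs = vecs (words K r) t
      cs : List (Vec (Fin K) (r * t))
      cs = combos (L.allFin K) (r * t)
      len-z : length zs ≡ K ^ (r * t)
      len-z = trans (length-vecs (words K r) t) (trans (cong (_^ t) (length-words K r)) (^-*-assoc K r t))
      instance
        K≢0 : NonZero K
        K≢0 = >-nonZero 1≤K
        K^≢0 : NonZero (K ^ (r * t))
        K^≢0 = m^n≢0 K (r * t)
      lem : ∀ a b c → a * (b * c) ≡ b * (c * a)
      lem = solve-∀
      prop : ∀ {p} → p ∈ cartesianProduct bad zs → Twisted σ τ π (proj₁ p) × VU.Unique (V.concat (proj₁ p))
      prop {p} p∈ = proj₂ (∈-filter⁻ bad? {xs = outcomes} (proj₁ (∈-cartesianProduct⁻ bad zs p∈)))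
      into : ∀ {p} → p ∈ cartesianProduct bad zs → exchange p ∈ cartesianProduct outcomes cs
      into {ω , z} p∈ = ∈-cartesianProduct⁺ (∈-outcomes _) (increasing-combos (readOff ω)
        (readOff-increasing ω (proj₁ (prop p∈)) (unique⇒tieFree ω (proj₂ (prop p∈)))))
      inj : ∀ {p q} → p ∈ cartesianProduct bad zs → q ∈ cartesianProduct bad zs → exchange p ≡ exchange q → p ≡ q
      inj p∈ q∈ = exchange-injective (proj₁ (prop p∈)) (proj₁ (prop q∈))

  module _ (t : ℕ) where

    private
      overπ : Vec (Fin n) t → Vec (Fin n) t → List Outcome
      overπ σ τ = concatMap (Fixed.bad σ τ) (vecs (words r r) t)

      overτ : Vec (Fin n) t → List Outcome
      overτ σ = concatMap (overπ σ) (words n t)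

    withTwins : List Outcome
    withTwins = concatMap overτ (combos (L.allFin n) t)

    ∈-withTwins : ∀ ω → VU.Unique (V.concat ω) → ∀ {k} → Twins (word ω) k → t ≤ k → ω ∈ withTwins
    ∈-withTwins ω u tw t≤k with twisted-from-twins ω (unique⇒tieFree ω u) tw t≤k
    ... | σ , τ , π , σ∈ , tws = ∈-concatMap overτ σ∈ (∈-concatMap (overπ σ) (∈-words τ)
      (∈-concatMap (Fixed.bad σ τ) (∈-vecs π (λ _ → ∈-words _)) (∈-filter⁺ (Fixed.bad? σ τ π) (∈-outcomes ω) (tws , u))))

    -- There are at most n^t / t! increasing σ, n^t words τ and (r^r)^t words π. The last factor is
    -- matched by the r^(rt) in (rt)^(rt), which `upper-numeric` extracts from (rt)!.
    length-withTwins : t ! * ((r * t) ! * length withTwins) ≤ n ^ t * (n ^ t * ((r ^ r) ^ t * K ^ (r * n)))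
    length-withTwins = begin
      t ! * ((r * t) ! * length withTwins) ≤⟨ *-monoʳ-≤ (t !)
        (length-concatMap-≤ overτ (combos (L.allFin n) t) X ((r * t) !) (λ {σ} _ → bτ σ)) ⟩
      t ! * (length (combos (L.allFin n) t) * X) ≡⟨ lem (t !) (length (combos (L.allFin n) t)) X ⟩
      length (combos (L.allFin n) t) * t ! * X ≤⟨ *-monoˡ-≤ X
        (subst (λ y → length (combos (L.allFin n) t) * t ! ≤ y ^ t) (length-allFin n) (length-combos (L.allFin n) t)) ⟩
      n ^ t * X ∎
      where
      open ≤-Reasoning
      X = n ^ t * ((r ^ r) ^ t * K ^ (r * n))
      lem : ∀ a b c → a * (b * c) ≡ b * a * c
      lem = solve-∀
      bπ : ∀ σ τ → (r * t) ! * length (overπ σ τ) ≤ (r ^ r) ^ t * K ^ (r * n)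
      bπ σ τ = ≤-trans (length-concatMap-≤ (Fixed.bad σ τ) (vecs (words r r) t) (K ^ (r * n)) ((r * t) !)
        (λ {π} _ → Fixed.length-bad σ τ π))
        (≤-reflexive (cong (_* K ^ (r * n)) (trans (length-vecs (words r r) t) (cong (_^ t) (length-words r r)))))
      bτ : ∀ σ → (r * t) ! * length (overτ σ) ≤ X
      bτ σ = ≤-trans (length-concatMap-≤ (overπ σ) (words n t) _ ((r * t) !) (λ {τ} _ → bπ σ τ))
        (≤-reflexive (cong (_* ((r ^ r) ^ t * K ^ (r * n))) (length-words n t)))

-- Integer roots, factorial estimates and the choice of scales

root : ∀ e x → 1 ≤ e → ∃ λ m → m ^ e ≤ x × x < suc m ^ e
root e@(suc _) zero _ = 0 , z≤n , ≤-reflexive (sym (^-zeroˡ e))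
root e (suc x) 1≤e with root e x 1≤e
... | m , lo , hi with suc m ^ e ≤? suc x
...   | no ¬le = m , m≤n⇒m≤1+n lo , ≰⇒> ¬le
...   | yes le = suc m , le , <-≤-trans (s≤s hi) (^-monoˡ-< e {{>-nonZero 1≤e}} (n<1+n (suc m)))

^-reflects-< : ∀ e a b → a ^ e < b ^ e → a < b
^-reflects-< e a b lt = ≰⇒> (λ le → <⇒≱ lt (^-monoˡ-≤ e le))

^-+1 : ∀ x r → x ^ (r + 1) ≡ x * x ^ r
^-+1 x r = cong (x ^_) (+-comm r 1)

<-suc-div : ∀ x y .{{_ : NonZero y}} → x < suc (x / y) * y
<-suc-div x y = subst (_< suc (x / y) * y) (sym (m≡m%n+[m/n]*n x y)) (+-monoˡ-< (x / y * y) (m%n<n x y))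

≤2^ : ∀ x → x ≤ 2 ^ x
≤2^ zero = z≤n
≤2^ (suc x) = ≤-trans (+-mono-≤ (m^n>0 2 x) (≤2^ x)) (+-monoʳ-≤ (2 ^ x) (≤-reflexive (sym (+-identityʳ _))))

-- In (x+1)^(t+1) ≤ x^(t+1) + (t+1)(x+1)^t each summand is, by induction, at most half of the
-- required bound. The case x = t stands in for Stirling's formula.
^≤2^*! : ∀ x t → x ^ t ≤ 2 ^ (x + t) * t !
^≤2^*! x zero = ≤-trans (m^n>0 2 (x + 0)) (≤-reflexive (sym (*-identityʳ _)))
^≤2^*! zero (suc t) = z≤n
^≤2^*! (suc x) (suc t) = begin
  suc x ^ suc t ≤⟨ convex x t ⟩
  x ^ suc t + suc t * suc x ^ t ≤⟨ +-mono-≤ (^≤2^*! x (suc t)) (*-monoʳ-≤ (suc t) (^≤2^*! (suc x) t)) ⟩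
  2 ^ (x + suc t) * suc t ! + suc t * (2 ^ (suc x + t) * t !) ≡⟨ cong
    (λ y → 2 ^ y * suc t ! + suc t * (2 ^ (suc x + t) * t !)) (+-suc x t) ⟩
  2 ^ suc (x + t) * (suc t * t !) + suc t * (2 ^ suc (x + t) * t !) ≡⟨ lem (2 ^ suc (x + t)) (suc t) (t !) ⟩
  2 * 2 ^ suc (x + t) * (suc t * t !) ≡⟨ cong (λ y → 2 * 2 ^ y * (suc t * t !)) (sym (+-suc x t)) ⟩
  2 ^ (suc x + suc t) * suc t ! ∎
  where
  open ≤-Reasoning
  lem : ∀ p a f → p * (a * f) + a * (p * f) ≡ 2 * p * (a * f)
  lem = solve-∀
  convex : ∀ x t → suc x ^ suc t ≤ x ^ suc t + suc t * suc x ^ t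
  convex x zero = ≤-reflexive (lem₂ x)
    where
    lem₂ : ∀ x → suc x * 1 ≡ x * 1 + 1 * 1
    lem₂ = solve-∀
  convex x (suc t) = begin
    suc x * suc x ^ suc t ≡⟨⟩
    suc x ^ suc t + x * suc x ^ suc t ≤⟨ +-monoʳ-≤ (suc x ^ suc t) (*-monoʳ-≤ x (convex x t)) ⟩
    suc x ^ suc t + x * (x ^ suc t + suc t * suc x ^ t) ≡⟨ lem₃ (suc x ^ suc t) x (x ^ suc t) (suc t) (suc x ^ t) ⟩
    x * x ^ suc t + (suc x ^ suc t + suc t * (x * suc x ^ t))
      ≤⟨ +-monoʳ-≤ (x * x ^ suc t) (+-monoʳ-≤ (suc x ^ suc t) (*-monoʳ-≤ (suc t) (*-monoˡ-≤ (suc x ^ t) (n≤1+n x)))) ⟩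
    x * x ^ suc t + (suc x ^ suc t + suc t * (suc x * suc x ^ t)) ∎
    where
    lem₃ : ∀ p x y t u → p + x * (y + t * u) ≡ x * y + (p + t * (x * u))
    lem₃ = solve-∀

t^t≤4^t*t! : ∀ t → t ^ t ≤ 4 ^ t * t !
t^t≤4^t*t! t = subst (λ y → t ^ t ≤ y * t !)
  (trans (cong (2 ^_) (cong (t +_) (sym (+-identityʳ t)))) (sym (^-*-assoc 2 2 t))) (^≤2^*! t t)

-- t! (rt)! ≥ (tʳ⁺¹ rʳ / 4ʳ⁺¹)ᵗ, so the first-moment bound is at most ((4ʳ⁺¹ n²) / tʳ⁺¹)ᵗ.
upper-numeric : ∀ r n t x y → 1 ≤ r → 1 ≤ n → 2 * (4 ^ (r + 1) * (n * n)) ≤ t ^ (r + 1) →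
  t ! * ((r * t) ! * x) ≤ n ^ t * (n ^ t * ((r ^ r) ^ t * y)) → 2 ^ t * x ≤ y
upper-numeric r n t x y 1≤r 1≤n t-large h = *-cancelʳ-≤ _ _ (c ^ t) (begin
  2 ^ t * x * c ^ t ≡⟨ lem₁ (2 ^ t) x (c ^ t) ⟩
  2 ^ t * c ^ t * x ≡⟨ cong (_* x) (sym (^-distribʳ-* 2 c t)) ⟩
  (2 * c) ^ t * x ≤⟨ *-monoˡ-≤ x (^-monoˡ-≤ t t-large) ⟩
  (t ^ (r + 1)) ^ t * x ≤⟨ *-cancelʳ-≤ _ _ ((r ^ r) ^ t) step ⟩
  c ^ t * y ≡⟨ *-comm (c ^ t) y ⟩
  y * c ^ t ∎)
  where
  open ≤-Reasoning
  c = 4 ^ (r + 1) * (n * n)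
  instance
    r≢0 : NonZero r
    r≢0 = >-nonZero 1≤r
    n≢0 : NonZero n
    n≢0 = >-nonZero 1≤n
    rr≢0 : NonZero (r ^ r)
    rr≢0 = m^n≢0 r r
    rrt≢0 : NonZero ((r ^ r) ^ t)
    rrt≢0 = m^n≢0 (r ^ r) t
    4≢0 : NonZero (4 ^ (r + 1))
    4≢0 = m^n≢0 4 (r + 1)
    nn≢0 : NonZero (n * n)
    nn≢0 = m*n≢0 n n
    c≢0 : NonZero c
    c≢0 = m*n≢0 (4 ^ (r + 1)) (n * n)
    ct≢0 : NonZero (c ^ t)
    ct≢0 = m^n≢0 c t
  lem₁ : ∀ a b c → a * b * c ≡ a * c * b
  lem₁ = solve-∀
  lem₂ : ∀ a b c d x → a * b * c * d * x ≡ a * c * (b * (d * x))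
  lem₂ = solve-∀
  powers : (t ^ (r + 1)) ^ t * (r ^ r) ^ t ≡ t ^ t * (r * t) ^ (r * t)
  powers = begin-equality
    (t ^ (r + 1)) ^ t * (r ^ r) ^ t ≡⟨ cong (λ z → z ^ t * (r ^ r) ^ t) (^-+1 t r) ⟩
    (t * t ^ r) ^ t * (r ^ r) ^ t ≡⟨ cong (_* (r ^ r) ^ t) (^-distribʳ-* t (t ^ r) t) ⟩
    t ^ t * (t ^ r) ^ t * (r ^ r) ^ t ≡⟨ *-assoc (t ^ t) _ _ ⟩
    t ^ t * ((t ^ r) ^ t * (r ^ r) ^ t) ≡⟨ cong (t ^ t *_) (*-comm ((t ^ r) ^ t) _) ⟩
    t ^ t * ((r ^ r) ^ t * (t ^ r) ^ t) ≡⟨ cong (t ^ t *_) (sym (^-distribʳ-* (r ^ r) (t ^ r) t)) ⟩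
    t ^ t * (r ^ r * t ^ r) ^ t ≡⟨ cong (λ z → t ^ t * z ^ t) (sym (^-distribʳ-* r t r)) ⟩
    t ^ t * ((r * t) ^ r) ^ t ≡⟨ cong (t ^ t *_) (^-*-assoc (r * t) r t) ⟩
    t ^ t * (r * t) ^ (r * t) ∎
  fours : 4 ^ t * 4 ^ (r * t) ≡ (4 ^ (r + 1)) ^ t
  fours = trans (sym (^-distribˡ-+-* 4 t (r * t))) (trans (cong (λ z → 4 ^ (z * t)) (+-comm 1 r)) (sym (^-*-assoc 4 (r + 1) t)))
  step : (t ^ (r + 1)) ^ t * x * (r ^ r) ^ t ≤ c ^ t * y * (r ^ r) ^ t
  step = begin
    (t ^ (r + 1)) ^ t * x * (r ^ r) ^ t ≡⟨ lem₁ ((t ^ (r + 1)) ^ t) x _ ⟩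
    (t ^ (r + 1)) ^ t * (r ^ r) ^ t * x ≡⟨ cong (_* x) powers ⟩
    t ^ t * (r * t) ^ (r * t) * x ≤⟨ *-monoˡ-≤ x (*-mono-≤ (t^t≤4^t*t! t) (t^t≤4^t*t! (r * t))) ⟩
    4 ^ t * t ! * (4 ^ (r * t) * (r * t) !) * x ≡⟨ lem₃ (4 ^ t) (t !) (4 ^ (r * t)) ((r * t) !) x ⟩
    4 ^ t * 4 ^ (r * t) * (t ! * ((r * t) ! * x)) ≤⟨ *-monoʳ-≤ (4 ^ t * 4 ^ (r * t)) h ⟩
    4 ^ t * 4 ^ (r * t) * (n ^ t * (n ^ t * ((r ^ r) ^ t * y))) ≡⟨ cong (_* (n ^ t * (n ^ t * ((r ^ r) ^ t * y)))) fours ⟩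
    (4 ^ (r + 1)) ^ t * (n ^ t * (n ^ t * ((r ^ r) ^ t * y))) ≡⟨ lem₄ ((4 ^ (r + 1)) ^ t) (n ^ t) ((r ^ r) ^ t) y ⟩
    (4 ^ (r + 1)) ^ t * (n ^ t * n ^ t) * y * (r ^ r) ^ t
      ≡⟨ cong (λ z → z * y * (r ^ r) ^ t) (trans (cong ((4 ^ (r + 1)) ^ t *_) (sym (^-distribʳ-* n n t)))
        (sym (^-distribʳ-* (4 ^ (r + 1)) (n * n) t))) ⟩
    c ^ t * y * (r ^ r) ^ t ∎
    where
    lem₃ : ∀ a b c d x → a * b * (c * d) * x ≡ a * c * (b * (d * x))
    lem₃ = solve-∀
    lem₄ : ∀ a b c y → a * (b * (b * (c * y))) ≡ a * (b * b) * y * c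
    lem₄ = solve-∀

-- R = ⌊n^(2/(r+1))⌋; N intervals; the first m₁ edges provide h boxes of degree at most d, and each of the next
-- m₂ edges then completes one of T pairs with probability at least 1 / q. Failures have probability O(2⁻ᵏ).
record Scales (r k n : ℕ) : Set where
  field
    R T N d h q m₁ m₂ : ℕ
    n≡ : n ≡ m₁ + m₂
    1≤n : 1 ≤ n
    R-lower : R ^ (r + 1) ≤ n ^ 2
    R-upper : n ^ 2 < suc R ^ (r + 1)
    R≤T : suc R ≤ 2 * (1536 * (r * r * r)) * T
    k≤R : k ≤ R
    1≤R : 1 ≤ R
    1≤d : 1 ≤ d
    1≤N : 1 ≤ N
    N-large : 8 * (r * r) ≤ N
    d-large : 8 * (r * r) * h ≤ d * N
    h-small : 4 * h ≤ N ^ r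
    T-small : 2 * (d * (r * T)) ≤ h
    q-large : 2 * N ^ r ≤ q * h
    1≤q : 1 ≤ q
    m₁-large : 4 * (h + k) ≤ m₁
    m₂-large : 2 * q * (T + k) ≤ m₂

-- With B = 1536 r³ and T* = k + A² + 8r², this forces R ≥ B T* and hence T ≥ T*, which gathers the
-- lower bounds imposed on T. In `A`, the summand 2^(r+1) serves n ≤ Nʳ and 32 serves N ≤ h.
threshold : ℕ → ℕ → ℕ
threshold r k = (1536 * (r * r * r) * (k + (A * A + 8 * (r * r)))) ^ (r + 1)
  where A = 2 ^ (r + 1) + 32

scales : ∀ r k n → 2 ≤ r → threshold r k ≤ n → Scales r k n
scales r k n 2≤r n-large = record
  { R = R ; T = T ; N = N ; d = d ; h = h ; q = q ; m₁ = 8 * h ; m₂ = n ∸ 8 * h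
  ; n≡ = sym (m+[n∸m]≡n (≤-trans (*-monoˡ-≤ h (m≤m+n 8 8)) 16h≤n))
  ; 1≤n = 1≤n ; R-lower = R-lower ; R-upper = R-upper ; R≤T = R≤T
  ; k≤R = ≤-trans k≤T (≤-trans T≤N N≤R) ; 1≤R = ≤-trans 1≤T (≤-trans T≤N N≤R)
  ; 1≤d = s≤s z≤n ; 1≤N = 1≤N
  ; N-large = ≤-trans (≤-trans (m≤n+m (8 * (r * r)) (A * A)) (m≤n+m _ k)) (≤-trans T*≤T T≤N)
  ; d-large = <⇒≤ (<-suc-div (8 * (r * r) * h) N)
  ; h-small = ≤-trans (*-monoˡ-≤ h (m≤m+n 4 12)) (≤-trans 16h≤n n≤N^r)
  ; T-small = T-small
  ; q-large = <⇒≤ (<-suc-div (2 * N ^ r) h)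
  ; 1≤q = s≤s z≤n
  ; m₁-large = ≤-trans (*-monoʳ-≤ 4 (+-monoʳ-≤ h k≤h)) (≤-reflexive (lem₄ h))
  ; m₂-large = m₂-large
  }
  where
  open ≤-Reasoning
  A B T* e : ℕ
  A = 2 ^ (r + 1) + 32
  -- The factor r³ is what `T-small` costs, and 1536 = 12 · 32² / 8 is what `m₂-large` costs.
  B = 1536 * (r * r * r)
  T* = k + (A * A + 8 * (r * r))
  e = r + 1
  lem₄ : ∀ h → 4 * (h + h) ≡ 8 * h
  lem₄ = solve-∀
  1≤r : 1 ≤ r
  1≤r = ≤-trans (n≤1+n 1) 2≤r
  instance
    r≢0 : NonZero r
    r≢0 = >-nonZero 1≤r
    rr≢0 : NonZero (r * r)
    rr≢0 = m*n≢0 r r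
    rrr≢0 : NonZero (r * r * r)
    rrr≢0 = m*n≢0 (r * r) r
    B≢0 : NonZero B
    B≢0 = m*n≢0 1536 (r * r * r)
  AA<T* : A * A < T*
  AA<T* = begin-strict
    A * A ≡⟨ sym (+-identityʳ _) ⟩
    A * A + 0 <⟨ +-monoʳ-< (A * A) (*-mono-≤ (s≤s (z≤n {7})) (>-nonZero⁻¹ (r * r))) ⟩
    A * A + 8 * (r * r) ≤⟨ m≤n+m _ k ⟩
    T* ∎
  1≤T* : 1 ≤ T*
  1≤T* = ≤-trans (s≤s z≤n) AA<T*
  1≤BT* : 1 ≤ B * T*
  1≤BT* = *-mono-≤ (>-nonZero⁻¹ B) 1≤T*
  1≤n : 1 ≤ n
  1≤n = ≤-trans (m^n>0 (B * T*) {{>-nonZero 1≤BT*}} e) n-large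
  n≤n² : n ≤ n ^ 2
  n≤n² = subst (_≤ n ^ 2) (*-identityʳ n) (*-monoʳ-≤ n (subst (1 ≤_) (sym (*-identityʳ n)) 1≤n))
  theRoot = root e (n ^ 2) (m≤n+m 1 r)
  R : ℕ
  R = proj₁ theRoot
  R-lower : R ^ (r + 1) ≤ n ^ 2
  R-lower = proj₁ (proj₂ theRoot)
  R-upper : n ^ 2 < suc R ^ (r + 1)
  R-upper = proj₂ (proj₂ theRoot)
  BT*≤R : B * T* ≤ R
  BT*≤R = s≤s⁻¹ (^-reflects-< e (B * T*) (suc R) (≤-<-trans (≤-trans n-large n≤n²) R-upper))
  T : ℕ
  T = R / B
  R<BT : R < suc T * B
  R<BT = <-suc-div R B
  T*≤T : T* ≤ T
  T*≤T = s≤s⁻¹ (*-cancelʳ-< B T* (suc T) (≤-<-trans (subst (_≤ R) (*-comm B T*) BT*≤R) R<BT))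
  1≤T : 1 ≤ T
  1≤T = ≤-trans 1≤T* T*≤T
  -- The ratio of N to T is exactly B, while N still differs from R by less than B.
  N : ℕ
  N = B * T
  T≤N : T ≤ N
  T≤N = m≤n*m T B
  1≤N : 1 ≤ N
  1≤N = ≤-trans 1≤T T≤N
  N≤R : N ≤ R
  N≤R = subst (_≤ R) (*-comm T B) (m/n*n≤m R B)
  R≤T : suc R ≤ 2 * B * T
  R≤T = begin
    suc R ≤⟨ R<BT ⟩
    suc T * B ≤⟨ *-monoˡ-≤ B (+-monoˡ-≤ T 1≤T) ⟩
    (T + T) * B ≡⟨ lem B T ⟩
    2 * B * T ∎
    where
    lem : ∀ B T → (T + T) * B ≡ 2 * B * T
    lem = solve-∀
  k≤T : k ≤ T
  k≤T = ≤-trans (m≤m+n k _) T*≤T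
  N^e≤n² : N ^ e ≤ n ^ 2
  N^e≤n² = ≤-trans (^-monoˡ-≤ e N≤R) R-lower
  instance
    N≢0 : NonZero N
    N≢0 = >-nonZero 1≤N
    NN≢0 : NonZero (N * N)
    NN≢0 = m*n≢0 N N
  -- N³ ≤ Nʳ⁺¹ ≤ n², so n < A N would give N < A².
  AN≤n : A * N ≤ n
  AN≤n with A * N ≤? n
  ... | yes le = le
  ... | no ¬le = ⊥-elim (<⇒≱ (<-≤-trans AA<T* (≤-trans T*≤T T≤N)) (*-cancelʳ-≤ N (A * A) (N * N) (begin
    N * (N * N) ≡⟨ lem N ⟩
    N ^ 3 ≤⟨ ^-monoʳ-≤ N (+-monoˡ-≤ 1 2≤r) ⟩
    N ^ e ≤⟨ N^e≤n² ⟩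
    n ^ 2 ≤⟨ ^-monoˡ-≤ 2 (<⇒≤ (≰⇒> ¬le)) ⟩
    (A * N) ^ 2 ≡⟨ lem₂ A N ⟩
    A * A * (N * N) ∎)))
    where
    lem : ∀ N → N * (N * N) ≡ N * (N * (N * 1))
    lem = solve-∀
    lem₂ : ∀ A N → A * N * (A * N * 1) ≡ A * A * (N * N)
    lem₂ = solve-∀
  -- From n² < (R + 1)^(r+1) ≤ 2^(r+1) N · Nʳ, one factor n is cancelled against 2^(r+1) N ≤ A N ≤
  -- n.
  n≤N^r : n ≤ N ^ r
  n≤N^r = *-cancelʳ-≤ n (N ^ r) (2 ^ e * N) {{2^e*N≢0}} (begin
    n * (2 ^ e * N) ≤⟨ *-monoʳ-≤ n (≤-trans (*-monoˡ-≤ N (m≤m+n (2 ^ e) 32)) AN≤n) ⟩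
    n * n ≡⟨ cong (n *_) (sym (*-identityʳ n)) ⟩
    n ^ 2 ≤⟨ <⇒≤ R-upper ⟩
    suc R ^ e ≤⟨ ^-monoˡ-≤ e R≤T ⟩
    (2 * B * T) ^ e ≡⟨ cong (_^ e) (*-assoc 2 B T) ⟩
    (2 * N) ^ e ≡⟨ ^-distribʳ-* 2 N e ⟩
    2 ^ e * N ^ e ≡⟨ cong (2 ^ e *_) (^-+1 N r) ⟩
    2 ^ e * (N * N ^ r) ≡⟨ lem (2 ^ e) N (N ^ r) ⟩
    N ^ r * (2 ^ e * N) ∎)
    where
    2^e*N≢0 : NonZero (2 ^ e * N)
    2^e*N≢0 = m*n≢0 (2 ^ e) N {{m^n≢0 2 e}}
    lem : ∀ a b c → a * (b * c) ≡ c * (a * b)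
    lem = solve-∀
  -- Collecting h boxes at success probability 1/2 takes 4(h + k) ≤ 8h edges, about half of n; at
  -- least 8h edges remain for the second phase.
  h : ℕ
  h = n / 16
  16h≤n : 16 * h ≤ n
  16h≤n = subst (_≤ n) (*-comm h 16) (m/n*n≤m n 16)
  n<16h+16 : n < suc h * 16
  n<16h+16 = <-suc-div n 16
  N≤h : N ≤ h
  N≤h = ≤-trans (m≤m+n N (N + 0)) (s≤s⁻¹ (*-cancelʳ-< 16 (2 * N) (suc h) (begin-strict
    2 * N * 16 ≡⟨ lem N ⟩
    32 * N ≤⟨ *-monoˡ-≤ N (m≤n+m 32 (2 ^ e)) ⟩
    A * N ≤⟨ AN≤n ⟩
    n <⟨ n<16h+16 ⟩
    suc h * 16 ∎)))
    where
    lem : ∀ N → 2 * N * 16 ≡ 32 * N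
    lem = solve-∀
  k≤h : k ≤ h
  k≤h = ≤-trans k≤T (≤-trans T≤N N≤h)
  1≤h : 1 ≤ h
  1≤h = ≤-trans 1≤N N≤h
  instance
    h≢0 : NonZero h
    h≢0 = >-nonZero 1≤h
  -- `suc` rounds the quotients up and keeps them positive. The cap d is about 8r times r h / N, the
  -- average degree of h boxes.
  d q : ℕ
  d = suc (8 * (r * r) * h / N)
  q = suc (2 * N ^ r / h)
  -- d N ≤ N + 8r²h ≤ 9r²h, and the factor 2r gives the 18r³ that B has to cover.
  T-small : 2 * (d * (r * T)) ≤ h
  T-small = *-cancelˡ-≤ B (begin
    B * (2 * (d * (r * T))) ≡⟨ lem B d r T ⟩
    2 * r * (d * N) ≤⟨ *-monoʳ-≤ (2 * r) (+-mono-≤ N≤h (m/n*n≤m (8 * (r * r) * h) N)) ⟩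
    2 * r * (h + 8 * (r * r) * h) ≤⟨ *-monoʳ-≤ (2 * r) (+-monoˡ-≤ _ (m≤n*m h (r * r))) ⟩
    2 * r * (r * r * h + 8 * (r * r) * h) ≡⟨ lem₂ r h ⟩
    18 * (r * r * r) * h ≤⟨ *-monoˡ-≤ h (*-monoˡ-≤ (r * r * r) (m≤m+n 18 1518)) ⟩
    B * h ∎)
    where
    lem : ∀ B d r T → B * (2 * (d * (r * T))) ≡ 2 * r * (d * (B * T))
    lem = solve-∀
    lem₂ : ∀ r h → 2 * r * (r * r * h + 8 * (r * r) * h) ≡ 18 * (r * r * r) * h
    lem₂ = solve-∀
  n≤32h : n ≤ 32 * h
  n≤32h = begin
    n ≤⟨ <⇒≤ n<16h+16 ⟩
    suc h * 16 ≤⟨ *-monoˡ-≤ 16 (+-monoˡ-≤ h 1≤h) ⟩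
    (h + h) * 16 ≡⟨ lem h ⟩
    32 * h ∎
    where
    lem : ∀ h → (h + h) * 16 ≡ 32 * h
    lem = solve-∀
  qh≤3N^r : q * h ≤ 3 * N ^ r
  qh≤3N^r = begin
    h + 2 * N ^ r / h * h ≤⟨ +-mono-≤ (≤-trans (m≤n*m h 16) (≤-trans 16h≤n n≤N^r)) (m/n*n≤m (2 * N ^ r) h) ⟩
    N ^ r + 2 * N ^ r ≡⟨⟩
    3 * N ^ r ∎
  -- By qh ≤ 3Nʳ and k ≤ T, multiplying by B h leaves at most 12 Nʳ⁺¹ ≤ 12 n² ≤ 12 (32h)² = 1536 h ·
  -- 8h.
  m₂-large : 2 * q * (T + k) ≤ n ∸ 8 * h
  m₂-large = ≤-trans (*-cancelˡ-≤ (B * h) {{m*n≢0 B h}} (begin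
    B * h * (2 * q * (T + k)) ≤⟨ *-monoʳ-≤ (B * h) (*-monoʳ-≤ (2 * q) (+-monoʳ-≤ T k≤T)) ⟩
    B * h * (2 * q * (T + T)) ≡⟨ lem B h q T ⟩
    4 * (q * h) * (B * T) ≤⟨ *-monoˡ-≤ (B * T) (*-monoʳ-≤ 4 qh≤3N^r) ⟩
    4 * (3 * N ^ r) * N ≡⟨ lem₂ (N ^ r) N ⟩
    12 * (N * N ^ r) ≡⟨ cong (12 *_) (sym (^-+1 N r)) ⟩
    12 * N ^ e ≤⟨ *-monoʳ-≤ 12 (≤-trans N^e≤n² (^-monoˡ-≤ 2 n≤32h)) ⟩
    12 * (32 * h) ^ 2 ≡⟨ lem₃ h ⟩
    1536 * h * (8 * h) ≤⟨ *-monoˡ-≤ (8 * h) (*-monoˡ-≤ h (m≤m*n 1536 (r * r * r))) ⟩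
    B * h * (8 * h) ∎))
    (m+n≤o⇒m≤o∸n (8 * h) (≤-trans (≤-reflexive (lem₅ h)) 16h≤n))
    where
    lem : ∀ B h q T → B * h * (2 * q * (T + T)) ≡ 4 * (q * h) * (B * T)
    lem = solve-∀
    lem₂ : ∀ p N → 4 * (3 * p) * N ≡ 12 * (N * p)
    lem₂ = solve-∀
    lem₃ : ∀ h → 12 * (32 * h * (32 * h * 1)) ≡ 1536 * h * (8 * h)
    lem₃ = solve-∀
    lem₅ : ∀ h → 8 * h + 8 * h ≡ 16 * h
    lem₅ = solve-∀

-- Failure events and transfer to uniform matchings

module Conclusion (r n k : ℕ) (2≤r : 2 ≤ r) (1≤k : 1 ≤ k) (scale : Scales r (4 * k + 1) n) where

  open Scales scale

  -- Q makes the number of labels so large that ties have probability at most 1 / 4k.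
  B Q K E t₀ : ℕ
  B = 1536 * (r * r * r)
  Q = 4 * k * (n * r) ^ 2
  K = N * Q
  E = K ^ (r * n)
  -- 8 = 4 · 2: the 4 absorbs the 4^(r+1) of the first moment, and 2^(r+1) ≥ 2 is the surplus that
  -- makes it at most 2^-t₀.
  t₀ = 8 * suc R

  1≤r : 1 ≤ r
  1≤r = ≤-trans (n≤1+n 1) 2≤r

  1≤Q : 1 ≤ Q
  1≤Q = *-mono-≤ (*-mono-≤ (s≤s (z≤n {3})) 1≤k) (m^n>0 (n * r) {{>-nonZero (*-mono-≤ 1≤n 1≤r)}} 2)

  1≤K : 1 ≤ K
  1≤K = *-mono-≤ 1≤N 1≤Q

  open Outcomes K n r 1≤r
  open LowerTransfer N Q n r 1≤r
  open UpperCount K n r 1≤r 1≤K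
  module Bx = Boxes N r

  instance
    K≢0 : NonZero K
    K≢0 = >-nonZero 1≤K
    E≢0 : NonZero E
    E≢0 = m^n≢0 K (r * n)
    k≢0 : NonZero k
    k≢0 = >-nonZero 1≤k

  tied? : Decidable (λ (ω : Outcome) → ¬ VU.Unique (V.concat ω))
  tied? ω = ¬? (uniqueVec? (V.concat ω))

  tied : List Outcome
  tied = filter tied? outcomes

  concat-injective : ∀ (ω ω′ : Outcome) → V.concat ω ≡ V.concat ω′ → ω ≡ ω′
  concat-injective ω ω′ e = vec-ext ω ω′ (λ j → vec-ext _ _ (λ s →
    trans (sym (VP.lookup-concat ω j s)) (trans (cong (λ v → V.lookup v (F.combine j s)) e) (VP.lookup-concat ω′ j s))))

  -- The birthday bound for n r labels, with K ≥ Q.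
  length-tied : 4 * k * length tied ≤ E
  length-tied = *-cancelˡ-≤ K (begin
    K * (4 * k * length tied) ≡⟨ lem K (4 * k) (length tied) ⟩
    4 * k * (K * length tied)
      ≤⟨ *-monoʳ-≤ (4 * k) (*-monoʳ-≤ K (unique-inj-length V.concat (UP.filter⁺ tied? outcomes-unique)
           (λ {ω} ω∈ → ∈-repeating (V.concat ω) (proj₂ (∈-filter⁻ tied? {xs = outcomes} ω∈))) (λ _ _ → concat-injective _ _))) ⟩
    4 * k * (K * length (repeating (L.allFin K) (n * r)))
      ≤⟨ *-monoʳ-≤ (4 * k) (subst (λ y → y * length (repeating (L.allFin K) (n * r)) ≤ (n * r) ^ 2 * y ^ (n * r))
        (length-allFin K) (length-repeating (L.allFin K) (n * r))) ⟩
    4 * k * ((n * r) ^ 2 * K ^ (n * r)) ≡⟨ sym (*-assoc (4 * k) _ _) ⟩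
    Q * K ^ (n * r) ≤⟨ *-monoˡ-≤ (K ^ (n * r)) (m≤n*m Q N {{>-nonZero 1≤N}}) ⟩
    K * K ^ (n * r) ≡⟨ cong (λ y → K * K ^ y) (*-comm n r) ⟩
    K * E ∎)
    where
    open ≤-Reasoning
    lem : ∀ a b c → a * (b * c) ≡ b * (a * c)
    lem = solve-∀

  unpairedBoxes : ∀ {n′} → n′ ≡ m₁ + m₂ → Σ (List (Vec Bx.Box n′)) λ βs →
    2 ^ (4 * k + 1) * length βs ≤ 2 * (N ^ r) ^ n′ × (∀ β → β ∈ βs ⊎ Bx.Pairing β T)
  unpairedBoxes refl =
    Bx.unpaired d h T q (4 * k + 1) m₁ m₂ 1≤d 1≤N N-large d-large h-small T-small q-large 1≤q m₁-large m₂-large ,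
    Bx.length-unpaired d h T q (4 * k + 1) m₁ m₂ 1≤d 1≤N N-large d-large h-small T-small q-large 1≤q m₁-large m₂-large ,
    Bx.unpaired-or-pairing d h T q (4 * k + 1) m₁ m₂ 1≤d 1≤N N-large d-large h-small T-small q-large 1≤q m₁-large m₂-large

  unpaired : List Outcome
  unpaired = refinements (proj₁ (unpairedBoxes n≡))

  -- In the exponent 4k + 1 the extra 1 pays for the factor 2 of the two phases; 2^(4k) ≥ 4k does
  -- the rest.
  length-unpaired : 4 * k * length unpaired ≤ E
  length-unpaired = ≤-trans (*-monoˡ-≤ (length unpaired) (≤2^ (4 * k))) (*-cancelˡ-≤ 2 (begin
    2 * (2 ^ (4 * k) * length unpaired) ≡⟨ sym (*-assoc 2 (2 ^ (4 * k)) _) ⟩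
    2 * 2 ^ (4 * k) * length unpaired ≡⟨ cong (_* length unpaired) (sym (^-+1 2 (4 * k))) ⟩
    2 ^ (4 * k + 1) * length unpaired ≤⟨ length-refinements (2 ^ (4 * k + 1)) 2 (proj₁ (unpairedBoxes n≡))
      (proj₁ (proj₂ (unpairedBoxes n≡))) ⟩
    2 * E ∎))
    where open ≤-Reasoning

  -- Here `k≤R` reads 4k + 1 ≤ R, so t₀ ≥ 4k and the failure probability 2^-t₀ is at most 1 / (4k).
  length-excessive : 4 * k * length (withTwins t₀) ≤ E
  length-excessive = ≤-trans (*-monoˡ-≤ (length (withTwins t₀)) (≤-trans (≤2^ (4 * k)) (^-monoʳ-≤ 2 4k≤t₀)))
    (upper-numeric r n t₀ (length (withTwins t₀)) E 1≤r 1≤n t₀-large (length-withTwins t₀))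
    where
    open ≤-Reasoning
    4k≤t₀ : 4 * k ≤ t₀
    4k≤t₀ = ≤-trans (m≤m+n (4 * k) 1) (≤-trans k≤R (≤-trans (n≤1+n R) (m≤n*m (suc R) 8)))
    t₀-large : 2 * (4 ^ (r + 1) * (n * n)) ≤ t₀ ^ (r + 1)
    t₀-large = begin
      2 * (4 ^ (r + 1) * (n * n)) ≤⟨ *-monoˡ-≤ (4 ^ (r + 1) * (n * n))
        (≤-trans (m≤m*n 2 (2 ^ r) {{m^n≢0 2 r}}) (≤-reflexive (sym (^-+1 2 r)))) ⟩
      2 ^ (r + 1) * (4 ^ (r + 1) * (n * n)) ≡⟨ sym (*-assoc (2 ^ (r + 1)) _ _) ⟩
      2 ^ (r + 1) * 4 ^ (r + 1) * (n * n) ≡⟨ cong₂ _*_ (sym (^-distribʳ-* 2 4 (r + 1))) (cong (n *_) (sym (*-identityʳ n))) ⟩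
      8 ^ (r + 1) * n ^ 2 ≤⟨ *-monoʳ-≤ (8 ^ (r + 1)) (<⇒≤ R-upper) ⟩
      8 ^ (r + 1) * suc R ^ (r + 1) ≡⟨ sym (^-distribʳ-* 8 (suc R) (r + 1)) ⟩
      t₀ ^ (r + 1) ∎

  size : Outcome → ℕ
  size ω = proj₁ (twinNumber (word ω))

  -- The constants come from R + 1 ≤ 2 B T and t₀ = 8 (R + 1) ≤ 16 R, where R ≤ n^(2/(r+1)) < R + 1.
  inWindow : ∀ t → T ≤ t → t < t₀ → InWindow r n 1 (2 * B) 16 1 t
  inWindow t T≤t t<t₀ = lower , upper
    where
    open ≤-Reasoning
    lower : 1 ^ (r + 1) * n ^ 2 ≤ (2 * B) ^ (r + 1) * t ^ (r + 1)
    lower = begin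
      1 ^ (r + 1) * n ^ 2 ≡⟨ trans (cong (_* n ^ 2) (^-zeroˡ (r + 1))) (*-identityˡ _) ⟩
      n ^ 2 ≤⟨ <⇒≤ R-upper ⟩
      suc R ^ (r + 1) ≤⟨ ^-monoˡ-≤ (r + 1) (≤-trans R≤T (*-monoʳ-≤ (2 * B) T≤t)) ⟩
      (2 * B * t) ^ (r + 1) ≡⟨ ^-distribʳ-* (2 * B) t (r + 1) ⟩
      (2 * B) ^ (r + 1) * t ^ (r + 1) ∎
    upper : 1 ^ (r + 1) * t ^ (r + 1) ≤ 16 ^ (r + 1) * n ^ 2
    upper = begin
      1 ^ (r + 1) * t ^ (r + 1) ≡⟨ trans (cong (_* t ^ (r + 1)) (^-zeroˡ (r + 1))) (*-identityˡ _) ⟩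
      t ^ (r + 1) ≤⟨ ^-monoˡ-≤ (r + 1) (≤-trans (<⇒≤ t<t₀) (*-monoʳ-≤ 8 (+-monoˡ-≤ R 1≤R))) ⟩
      (8 * (R + R)) ^ (r + 1) ≡⟨ cong (_^ (r + 1)) (lem R) ⟩
      (16 * R) ^ (r + 1) ≡⟨ ^-distribʳ-* 16 R (r + 1) ⟩
      16 ^ (r + 1) * R ^ (r + 1) ≤⟨ *-monoʳ-≤ (16 ^ (r + 1)) R-lower ⟩
      16 ^ (r + 1) * n ^ 2 ∎
      where
      lem : ∀ R → 8 * (R + R) ≡ 16 * R
      lem = solve-∀

  Typical : Outcome → Set
  Typical ω = VU.Unique (V.concat ω) × T ≤ size ω × size ω < t₀

  typical? : Decidable Typical
  typical? ω = uniqueVec? (V.concat ω) ×-dec ((T ≤? size ω) ×-dec (size ω <? t₀))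

  typical atypical : List Outcome
  typical = filter typical? outcomes
  atypical = filter (¬? ∘ typical?) outcomes

  exceptions : List Outcome
  exceptions = tied ++ unpaired ++ withTwins t₀

  ¬typical⇒exception : ∀ ω → ¬ Typical ω → ω ∈ exceptions
  ¬typical⇒exception ω ¬typ =
    split (uniqueVec? (V.concat ω)) (t₀ ≤? size ω) (proj₂ (proj₂ (unpairedBoxes n≡)) (boxOf ω))
    where
    split : Dec (VU.Unique (V.concat ω)) → Dec (t₀ ≤ size ω) → boxOf ω ∈ proj₁ (unpairedBoxes n≡) ⊎ Bx.Pairing (boxOf ω) T →
      ω ∈ exceptions
    split (no ¬u) _ _ = ∈-++⁺ˡ (∈-filter⁺ tied? (∈-outcomes ω) ¬u)
    split (yes u) (yes le) _ = ∈-++⁺ʳ tied (∈-++⁺ʳ unpaired (∈-withTwins t₀ ω u (proj₁ (proj₂ (twinNumber (word ω)))) le))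
    split (yes u) (no ¬le) (inj₁ β∈) = ∈-++⁺ʳ tied (∈-++⁺ˡ (∈-refinements ω β∈))
    split (yes u) (no ¬le) (inj₂ pairs) =
      let t , T≤t , tw = twins-from-pairing ω (unique⇒tieFree ω u) pairs
      in ⊥-elim (¬typ (u , ≤-trans T≤t (proj₂ (proj₂ (twinNumber (word ω))) t tw) , ≰⇒> ¬le))

  -- Ties, missing pairs and excessive twins have probability at most 1 / (4k) each, which stays
  -- below 1 / k in total.
  length-exceptions : k * length exceptions ≤ E
  length-exceptions = *-cancelˡ-≤ 4 (begin
    4 * (k * length exceptions) ≡⟨ cong (λ y → 4 * (k * y))
      (trans (LP.length-++ tied) (cong (length tied +_) (LP.length-++ unpaired))) ⟩
    4 * (k * (length tied + (length unpaired + length (withTwins t₀)))) ≡⟨ lem k (length tied) (length unpaired)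
      (length (withTwins t₀)) ⟩
    4 * k * length tied + (4 * k * length unpaired + 4 * k * length (withTwins t₀)) ≤⟨ +-mono-≤ length-tied
      (+-mono-≤ length-unpaired length-excessive) ⟩
    E + (E + E) ≤⟨ +-monoʳ-≤ E (+-monoʳ-≤ E (m≤m+n E (E + 0))) ⟩
    4 * E ∎)
    where
    open ≤-Reasoning
    lem : ∀ k a b c → 4 * (k * (a + (b + c))) ≡ 4 * k * a + (4 * k * b + 4 * k * c)
    lem = solve-∀

  length-typical : (k ∸ 1) * E ≤ k * length typical
  length-typical = +-cancelʳ-≤ E _ _ (begin
    (k ∸ 1) * E + E ≡⟨ +-comm ((k ∸ 1) * E) E ⟩
    suc (k ∸ 1) * E ≡⟨ cong (_* E) (suc-pred k) ⟩
    k * E ≡⟨ cong (k *_) (sym (trans (length-filter-split typical? outcomes) length-outcomes)) ⟩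
    k * (length typical + length atypical) ≡⟨ *-distribˡ-+ k (length typical) _ ⟩
    k * length typical + k * length atypical ≤⟨ +-monoʳ-≤ (k * length typical) few ⟩
    k * length typical + E ∎)
    where
    open ≤-Reasoning
    few : k * length atypical ≤ E
    few = ≤-trans (*-monoʳ-≤ k (unique-⊆-length (UP.filter⁺ (¬? ∘ typical?) outcomes-unique)
      (λ {ω} ω∈ → ¬typical⇒exception ω (proj₂ (∈-filter⁻ (¬? ∘ typical?) {xs = outcomes} ω∈))))) length-exceptions

  _≟ʷ_ : DecidableEquality (Word (r * n) n)
  _≟ʷ_ = VP.≡-dec FP._≟_

  matchings : List (Word (r * n) n)
  matchings = deduplicate _≟ʷ_ (L.map word typical)

  matchings-good : All (Good r n 1 (2 * B) 16 1) matchings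
  matchings-good = All.tabulate (λ w∈ → good (∈-map⁻ word (∈-deduplicate⁻ _≟ʷ_ (L.map word typical) w∈)))
    where
    good : ∀ {w} → (∃ λ ω → ω ∈ typical × w ≡ word ω) → Good r n 1 (2 * B) 16 1 w
    good (ω , ω∈ , refl) =
      let _ , T≤ , <t₀ = proj₂ (∈-filter⁻ typical? {xs = outcomes} ω∈)
      in word-matching ω , size ω , proj₂ (twinNumber (word ω)) , inWindow (size ω) T≤ <t₀

  -- At least (1 - 1/k) E outcomes are typical, and each matching accounts for at most E (r!)ⁿ n! /
  -- (rn)! of them; E cancels.
  conclusion : ProbAtLeast r n 1 (2 * B) 16 1 k
  conclusion = matchings , UDP.deduplicate-! _≟ʷ_ (L.map word typical) , matchings-good , *-cancelˡ-≤ E (begin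
    E * ((k ∸ 1) * (r * n) !) ≡⟨ lem E (k ∸ 1) ((r * n) !) ⟩
    (k ∸ 1) * E * (r * n) ! ≤⟨ *-monoˡ-≤ ((r * n) !) length-typical ⟩
    k * length typical * (r * n) ! ≡⟨ *-assoc k (length typical) _ ⟩
    k * (length typical * (r * n) !) ≤⟨ *-monoʳ-≤ k (length-words-of (UP.filter⁺ typical? outcomes-unique) into) ⟩
    k * (E * (length matchings * ((r !) ^ n * n !))) ≡⟨ lem₂ k E (length matchings) ((r !) ^ n * n !) ⟩
    E * (k * length matchings * ((r !) ^ n * n !)) ∎)
    where
    open ≤-Reasoning
    lem : ∀ E a b → E * (a * b) ≡ a * E * b
    lem = solve-∀
    lem₂ : ∀ k E m c → k * (E * (m * c)) ≡ E * (k * m * c)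
    lem₂ = solve-∀
    into : ∀ {ω} → ω ∈ typical → TieFree ω × word ω ∈ matchings
    into {ω} ω∈ = unique⇒tieFree ω (proj₁ (proj₂ (∈-filter⁻ typical? {xs = outcomes} ω∈))) ,
      ∈-deduplicate⁺ _≟ʷ_ (∈-map⁺ word ω∈)

theorem1p1 : ∀ (r : ℕ) → 2 ≤ r →
    ∃ λ cn → ∃ λ cd → ∃ λ Cn → ∃ λ Cd →
    (1 ≤ cn) × (1 ≤ cd) × (1 ≤ Cn) × (1 ≤ Cd) × (cn * Cd ≤ Cn * cd) ×
    (∀ (k : ℕ) → 1 ≤ k → ∃ λ N → ∀ n → N ≤ n → ProbAtLeast r n cn cd Cn Cd k)
theorem1p1 r 2≤r =
  1 , 2 * (1536 * (r * r * r)) , 16 , 1 , s≤s z≤n , 1≤cd , s≤s z≤n , s≤s z≤n ,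
  ≤-trans 1≤cd (m≤n*m _ 16) ,
  λ k 1≤k → threshold r (4 * k + 1) , λ n large →
    Conclusion.conclusion r n k 2≤r 1≤k (scales r (4 * k + 1) n 2≤r large)
  where
  1≤r : 1 ≤ r
  1≤r = ≤-trans (n≤1+n 1) 2≤r
  1≤cd : 1 ≤ 2 * (1536 * (r * r * r))
  1≤cd = *-mono-≤ (s≤s (z≤n {1})) (*-mono-≤ (s≤s (z≤n {1535})) (*-mono-≤ (*-mono-≤ 1≤r 1≤r) 1≤r))
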